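{- Let $p>5$ be a prime, $a\in\mathbb Z_p$ with $a\not\equiv-1\pmod p$, and $a'=(a-\langle a\rangle_p)/p$. Then $$\sum_{k=0}^{p-1}k^3\binom ak\binom{ -1-a}k\binom{2k}k\frac1{4^k}\equiv\frac{a^2(a+1)^2(2a+1)^2}{15}S_p(a)-\frac{(a+1)^2\big(4a^2(a+1)^2-a(a+1)+1\big)}{15}S_p(a+1)+\frac{4a^4+6a^3-a^2+a+5}{15(a+1)}a'(a'+1)p^3\pmod{p^4}.$$
   Context: For a prime $p$, $\mathbb Z_p$ denotes the set of rational numbers whose denominator is not divisible by $p$, and congruences modulo powers of $p$ are between elements of $\mathbb Z_p$ (the difference divided by that power of $p$ lies in $\mathbb Z_p$). For $a\in\mathbb Z_p$, $\langle a\rangle_p\in\{0,1,\ldots,p-1\}$ is determined by $a\equiv\langle a\rangle_p\pmod p$. For rational $a$ and integer $k\ge0$, $\binom ak=a(a-1)\cdots(a-k+1)/k!$. Define $S_n(a)=\sum_{k=0}^{n-1}\binom ak\binom{ -1-a}k\binom{2k}k\frac1{4^k}$ for $n\ge1$. -}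

module Defs where

open import Algebra.Definitions.RawSemiring using (_^_; sum)
open import Data.Integer.Base as ℤ using (ℤ; +_)
import Data.Integer.DivMod as ℤ
import Data.Integer.Divisibility.Signed as ℤ
import Data.Integer.Properties as ℤ
open import Data.Integer.Tactic.RingSolver using (solve-∀)
open import Data.Fin.Base using (toℕ)
open import Data.Nat.Base as ℕ using (ℕ; zero; suc; _!)
open import Data.Nat.Combinatorics using (_C_)
import Data.Nat.Coprimality as ℕ
open import Data.Nat.Divisibility using (_∣_; ∣-trans; ∣⇒≤; ∣1⇒≡1; divides)
import Data.Nat.GCD as ℕ
open import Data.Nat.Primality using (Prime; prime⇒nonZero; prime⇒nonTrivial; prime⇒irreducible; euclidsLemma)
import Data.Nat.Properties as ℕ
open import Data.Product.Base using (_×_; _,_; proj₁; proj₂; ∃)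
open import Data.Product using (∃!)
open import Data.Rational.Base
open import Data.Rational.Literals using (fromℤ)
open import Data.Rational.Properties
open import Data.Rational.Solver using (module +-*-Solver)
open import Data.Rational.Unnormalised.Base as ℚᵘ using (mkℚᵘ; *≡*)
import Data.Rational.Unnormalised.Properties as ℚᵘ
open import Data.Sum.Base using (inj₁; inj₂; [_,_]′)
open import Function.Base using (_∘_)
open import Level using (0ℓ)
open import Relation.Binary.PropositionalEquality
open import Relation.Nullary.Negation using (¬_; contradiction)
open import Relation.Unary using (Pred; _∈_)

ι : ℕ → ℚ
ι n = fromℤ (+ n)

infixr 8 _^ℚ_

_^ℚ_ : ℚ → ℕ → ℚ
_^ℚ_ = _^_ +-*-rawSemiring

-- ∑ n f = f 0 + f 1 + ⋯ + f (n - 1)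
∑ : ℕ → (ℕ → ℚ) → ℚ
∑ n f = sum +-*-rawSemiring {n} (f ∘ toℕ)

falling : ℚ → ℕ → ℚ
falling a zero    = 1ℚ
falling a (suc k) = falling a k * (a - ι k)

binom : ℚ → ℕ → ℚ
binom a k = falling a k * (+ 1 / k !)
  where instance _ = k ℕ.!≢0

summand : ℚ → ℕ → ℚ
summand a k = binom a k * binom (- 1ℚ - a) k * ι ((2 ℕ.* k) C k) * (+ 1 / (4 ℕ.^ k))
  where instance _ = ℕ.m^n≢0 4 k

S : ℕ → ℚ → ℚ
S n a = ∑ n (summand a)

fromℤ-+ : ∀ i j → fromℤ (i ℤ.+ j) ≡ fromℤ i + fromℤ j
fromℤ-+ i j = toℚᵘ-injective (ℚᵘ.≃-trans
  (*≡* (solve′ i j))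
  (ℚᵘ.≃-sym (toℚᵘ-homo-+ (fromℤ i) (fromℤ j))))
  where
  solve′ : ∀ i j → (i ℤ.+ j) ℤ.* + 1 ≡ (i ℤ.* + 1 ℤ.+ j ℤ.* + 1) ℤ.* + 1
  solve′ = solve-∀

fromℤ-* : ∀ i j → fromℤ (i ℤ.* j) ≡ fromℤ i * fromℤ j
fromℤ-* i j = toℚᵘ-injective (ℚᵘ.≃-trans
  (*≡* refl)
  (ℚᵘ.≃-sym (toℚᵘ-homo-* (fromℤ i) (fromℤ j))))

fromℤ-injective : ∀ {i j} → fromℤ i ≡ fromℤ j → i ≡ j
fromℤ-injective = cong ↥_

*-↧ : ∀ x → x * ι (↧ₙ x) ≡ fromℤ (↥ x)
*-↧ x@record{} = toℚᵘ-injective (ℚᵘ.≃-trans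
  (toℚᵘ-homo-* x (ι (↧ₙ x)))
  (*≡* (solve′ (↥ x) (↧ x))))
  where
  solve′ : ∀ n d → (n ℤ.* d) ℤ.* + 1 ≡ n ℤ.* (d ℤ.* + 1)
  solve′ = solve-∀

/-*-cancel : ∀ n .{{_ : ℕ.NonZero n}} → (+ 1 / n) * ι n ≡ 1ℚ
/-*-cancel n@(suc n-1) = toℚᵘ-injective (ℚᵘ.≃-trans
  (toℚᵘ-homo-* (+ 1 / n) (ι n))
  (ℚᵘ.≃-trans (ℚᵘ.*-congʳ (toℚᵘ-fromℚᵘ (mkℚᵘ (+ 1) n-1))) (*≡* (solve′ (+ n)))))
  where
  solve′ : ∀ n → (+ 1 ℤ.* n) ℤ.* + 1 ≡ + 1 ℤ.* (n ℤ.* + 1)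
  solve′ = solve-∀

module Localization (p : ℕ) (pr : Prime p) where

  private instance
    p≢0 : ℕ.NonZero p
    p≢0 = prime⇒nonZero pr

  -- The localization of ℤ at the prime p, as a subset of ℚ; ↧ₙ is the denominator in lowest terms.
  ℤₚ : Pred ℚ 0ℓ
  ℤₚ x = ¬ p ∣ ↧ₙ x

  1/p^_ : ℕ → ℚ
  1/p^ k = + 1 / (p ℕ.^ k)
    where instance _ = ℕ.m^n≢0 p k

  infix 4 _≡_[mod-p^_]

  -- Congruence modulo pᵏ is a relation between elements of ℤₚ, so both sides are required to lie there.
  record _≡_[mod-p^_] (x y : ℚ) (k : ℕ) : Set where
    constructor congruent
    field
      x∈ℤₚ     : x ∈ ℤₚ
      y∈ℤₚ     : y ∈ ℤₚ
      quotient : (x - y) * (1/p^ k) ∈ ℤₚ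

  p∤1 : ¬ p ∣ 1
  p∤1 p∣1 = ℕ.nonTrivial⇒≢1 {{prime⇒nonTrivial pr}} (∣1⇒≡1 p∣1)

  p∤* : ∀ {m n} → ¬ p ∣ m → ¬ p ∣ n → ¬ p ∣ m ℕ.* n
  p∤* {m} {n} p∤m p∤n = [ p∤m , p∤n ]′ ∘ euclidsLemma m n pr

  clear : ∀ x i d → x * ι d ≡ fromℤ i → ↥ x ℤ.* + d ≡ i ℤ.* ↧ x
  clear x i d eq = fromℤ-injective (begin
    fromℤ (↥ x ℤ.* + d)          ≡⟨ fromℤ-* (↥ x) (+ d) ⟩
    fromℤ (↥ x) * ι d            ≡⟨ cong (_* ι d) (*-↧ x) ⟨
    x * ι (↧ₙ x) * ι d           ≡⟨ swap x (ι (↧ₙ x)) (ι d) ⟩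
    x * ι d * ι (↧ₙ x)           ≡⟨ cong (_* ι (↧ₙ x)) eq ⟩
    fromℤ i * ι (↧ₙ x)           ≡⟨ fromℤ-* i (↧ x) ⟨
    fromℤ (i ℤ.* ↧ x)            ∎)
    where
    open ≡-Reasoning
    open +-*-Solver
    swap : ∀ a b c → a * b * c ≡ a * c * b
    swap = solve 3 (λ a b c → a :* b :* c := a :* c :* b) refl

  ∈ℤₚ : ∀ x i d → x * ι d ≡ fromℤ i → ¬ p ∣ d → x ∈ ℤₚ
  ∈ℤₚ x@(mkℚ _ _ c) i d eq p∤d p∣↧x = p∤d (∣-trans p∣↧x (ℕ.coprime-divisor
    (ℕ.sym (ℕ.recompute c))
    (subst (↧ₙ x ∣_) (ℤ.abs-* (↥ x) (+ d))
      (ℤ.∣⇒∣ᵤ (ℤ.divides i (clear x i d eq))))))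

  -∈ℤₚ : ∀ {x y} → x ∈ ℤₚ → y ∈ ℤₚ → x - y ∈ ℤₚ
  -∈ℤₚ {x} {y} x∈ y∈ = ∈ℤₚ (x - y) (↥ x ℤ.* ↧ y ℤ.- ↥ y ℤ.* ↧ x) (↧ₙ x ℕ.* ↧ₙ y) eq (p∤* x∈ y∈)
    where
    open ≡-Reasoning
    expand : ∀ x y c d → (x - y) * (c * d) ≡ x * c * d + - 1ℚ * (y * d * c)
    expand = solve 4 (λ x y c d → (x :- y) :* (c :* d) := x :* c :* d :+ con (- 1ℚ) :* (y :* d :* c)) refl
      where open +-*-Solver
    minus : ∀ i j → i ℤ.+ ℤ.-1ℤ ℤ.* j ≡ i ℤ.- j
    minus = solve-∀
    eq : (x - y) * ι (↧ₙ x ℕ.* ↧ₙ y) ≡ fromℤ (↥ x ℤ.* ↧ y ℤ.- ↥ y ℤ.* ↧ x)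
    eq = begin
      (x - y) * ι (↧ₙ x ℕ.* ↧ₙ y)
        ≡⟨ cong (λ i → (x - y) * fromℤ i) (ℤ.pos-* (↧ₙ x) (↧ₙ y)) ⟩
      (x - y) * fromℤ (↧ x ℤ.* ↧ y)
        ≡⟨ cong ((x - y) *_) (fromℤ-* (↧ x) (↧ y)) ⟩
      (x - y) * (ι (↧ₙ x) * ι (↧ₙ y))
        ≡⟨ expand x y (ι (↧ₙ x)) (ι (↧ₙ y)) ⟩
      x * ι (↧ₙ x) * ι (↧ₙ y) + - 1ℚ * (y * ι (↧ₙ y) * ι (↧ₙ x))
        ≡⟨ cong₂ (λ u v → u * ι (↧ₙ y) + - 1ℚ * (v * ι (↧ₙ x))) (*-↧ x) (*-↧ y) ⟩
      fromℤ (↥ x) * ι (↧ₙ y) + - 1ℚ * (fromℤ (↥ y) * ι (↧ₙ x))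
        ≡⟨ cong₂ (λ u v → u + - 1ℚ * v) (fromℤ-* (↥ x) (↧ y)) (fromℤ-* (↥ y) (↧ x)) ⟨
      fromℤ (↥ x ℤ.* ↧ y) + - 1ℚ * fromℤ (↥ y ℤ.* ↧ x)
        ≡⟨ cong (λ u → fromℤ (↥ x ℤ.* ↧ y) + u) (fromℤ-* ℤ.-1ℤ (↥ y ℤ.* ↧ x)) ⟨
      fromℤ (↥ x ℤ.* ↧ y) + fromℤ (ℤ.-1ℤ ℤ.* (↥ y ℤ.* ↧ x))
        ≡⟨ fromℤ-+ (↥ x ℤ.* ↧ y) _ ⟨
      fromℤ (↥ x ℤ.* ↧ y ℤ.+ ℤ.-1ℤ ℤ.* (↥ y ℤ.* ↧ x))
        ≡⟨ cong fromℤ (minus (↥ x ℤ.* ↧ y) (↥ y ℤ.* ↧ x)) ⟩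
      fromℤ (↥ x ℤ.* ↧ y ℤ.- ↥ y ℤ.* ↧ x) ∎

  1/p^1*p≡1 : (1/p^ 1) * ι p ≡ 1ℚ
  1/p^1*p≡1 = trans (cong (λ n → (1/p^ 1) * ι n) (sym (ℕ.^-identityʳ p)))
    (/-*-cancel (p ℕ.^ 1) {{ℕ.m^n≢0 p 1}})

  inverse : ∀ d → ¬ p ∣ d → ∃ λ e → + p ℤ.∣ e ℤ.* + d ℤ.- + 1
  inverse d p∤d with ℕ.coprime-Bézout {p} {d} coprime
    where
    coprime : ℕ.Coprime p d
    coprime (k∣p , k∣d) with prime⇒irreducible pr k∣p
    ... | inj₁ k≡1  = k≡1
    ... | inj₂ refl = contradiction k∣d p∤d
  ... | ℕ.Bézout.+- x y eq = ℤ.- (+ y) , ℤ.divides (ℤ.- (+ x)) (begin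
      ℤ.- (+ y) ℤ.* + d ℤ.- + 1         ≡⟨ lem (+ y) (+ d) ⟩
      ℤ.- (+ 1 ℤ.+ + y ℤ.* + d)         ≡⟨ cong (λ i → ℤ.- (+ 1 ℤ.+ i)) (ℤ.pos-* y d) ⟨
      ℤ.- (+ (1 ℕ.+ y ℕ.* d))           ≡⟨ cong (λ n → ℤ.- (+ n)) eq ⟩
      ℤ.- (+ (x ℕ.* p))                 ≡⟨ cong ℤ.-_ (ℤ.pos-* x p) ⟩
      ℤ.- (+ x ℤ.* + p)                 ≡⟨ ℤ.neg-distribˡ-* (+ x) (+ p) ⟩
      ℤ.- (+ x) ℤ.* + p                 ∎)
    where
    open ≡-Reasoning
    lem : ∀ y d → ℤ.- y ℤ.* d ℤ.- + 1 ≡ ℤ.- (+ 1 ℤ.+ y ℤ.* d)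
    lem = solve-∀
  ... | ℕ.Bézout.-+ x y eq = + y , ℤ.divides (+ x) (begin
      + y ℤ.* + d ℤ.- + 1               ≡⟨ cong (ℤ._- + 1) (ℤ.pos-* y d) ⟨
      + (y ℕ.* d) ℤ.- + 1               ≡⟨ cong (λ n → + n ℤ.- + 1) eq ⟨
      + 1 ℤ.+ + (x ℕ.* p) ℤ.- + 1       ≡⟨ lem (+ (x ℕ.* p)) ⟩
      + (x ℕ.* p)                       ≡⟨ ℤ.pos-* x p ⟩
      + x ℤ.* + p                       ∎)
    where
    open ≡-Reasoning
    lem : ∀ i → + 1 ℤ.+ i ℤ.- + 1 ≡ i
    lem = solve-∀

  residue-exists : ∀ a → a ∈ ℤₚ → ∃ λ r → r ℕ.< p × a ≡ ι r [mod-p^ 1 ]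
  residue-exists a a∈ with inverse (↧ₙ a) a∈
  ... | e , ℤ.divides t eq = r , ℤ.n%ℕd<d m p , congruent a∈ p∤1
        (∈ℤₚ ((a - ι r) * P) (ℤ.- (n ℤ.* t) ℤ.+ q ℤ.* d) (↧ₙ a) main a∈)
    where
    open ≡-Reasoning
    n = ↥ a
    d = ↧ a
    m = n ℤ.* e
    r = m ℤ.%ℕ p
    q = m ℤ./ℕ p
    P = 1/p^ 1
    lem₁ : ∀ n e d → n ≡ n ℤ.* e ℤ.* d ℤ.- n ℤ.* (e ℤ.* d ℤ.- + 1)
    lem₁ = solve-∀
    lem₂ : ∀ n t d r q p → (r ℤ.+ q ℤ.* p) ℤ.* d ℤ.- n ℤ.* (t ℤ.* p) ≡
           (ℤ.- (n ℤ.* t) ℤ.+ q ℤ.* d) ℤ.* p ℤ.+ r ℤ.* d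
    lem₂ = solve-∀
    num : n ≡ (ℤ.- (n ℤ.* t) ℤ.+ q ℤ.* d) ℤ.* + p ℤ.+ + r ℤ.* d
    num = begin
      n                                                 ≡⟨ lem₁ n e d ⟩
      m ℤ.* d ℤ.- n ℤ.* (e ℤ.* d ℤ.- + 1)
        ≡⟨ cong₂ (λ u v → u ℤ.* d ℤ.- n ℤ.* v) (ℤ.a≡a%ℕn+[a/ℕn]*n m p) eq ⟩
      (+ r ℤ.+ q ℤ.* + p) ℤ.* d ℤ.- n ℤ.* (t ℤ.* + p)   ≡⟨ lem₂ n t d (+ r) q (+ p) ⟩
      (ℤ.- (n ℤ.* t) ℤ.+ q ℤ.* d) ℤ.* + p ℤ.+ + r ℤ.* d ∎
    z = ℤ.- (n ℤ.* t) ℤ.+ q ℤ.* d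
    open +-*-Solver
    main : (a - ι r) * P * ι (↧ₙ a) ≡ fromℤ z
    main = begin
      (a - ι r) * P * ι (↧ₙ a)
        ≡⟨ solve 4 (λ a r P d → (a :- r) :* P :* d := (a :* d :- r :* d) :* P) refl a (ι r) P (ι (↧ₙ a)) ⟩
      (a * ι (↧ₙ a) - ι r * ι (↧ₙ a)) * P
        ≡⟨ cong (λ u → (u - ι r * ι (↧ₙ a)) * P) (trans (*-↧ a) (cong fromℤ num)) ⟩
      (fromℤ (z ℤ.* + p ℤ.+ + r ℤ.* d) - ι r * ι (↧ₙ a)) * P
        ≡⟨ cong (λ u → (u - ι r * ι (↧ₙ a)) * P)
             (trans (fromℤ-+ (z ℤ.* + p) (+ r ℤ.* d)) (cong₂ _+_ (fromℤ-* z (+ p)) (fromℤ-* (+ r) d))) ⟩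
      (fromℤ z * ι p + ι r * ι (↧ₙ a) - ι r * ι (↧ₙ a)) * P
        ≡⟨ solve 4 (λ z p w P → (z :* p :+ w :- w) :* P := z :* (P :* p)) refl (fromℤ z) (ι p) (ι r * ι (↧ₙ a)) P ⟩
      fromℤ z * (P * ι p)
        ≡⟨ cong (fromℤ z *_) 1/p^1*p≡1 ⟩
      fromℤ z * 1ℚ
        ≡⟨ *-identityʳ (fromℤ z) ⟩
      fromℤ z ∎

  residue-unique-+ : ∀ a r u P → P * ι p ≡ 1ℚ →
                     (a - ι r) * P ∈ ℤₚ → (a - ι (r ℕ.+ u)) * P ∈ ℤₚ →
                     r ℕ.+ u ℕ.< p → u ≡ 0
  residue-unique-+ a r u P P*p≡1 a-r a-s r+u<p =
    small u (ℕ.≤-<-trans (ℕ.m≤n+m u r) r+u<p)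
      (p∣u ((a - ι r) * P) ((a - ι (r ℕ.+ u)) * P) a-r a-s (difference (ι (r ℕ.+ u)) (fromℤ-+ (+ r) (+ u))))
    where
    open ≡-Reasoning
    factor : ∀ a r u P p → ((a - r) * P - (a - (r + u)) * P) * p ≡ u * (P * p)
    factor = solve 5 (λ a r u P p → ((a :- r) :* P :- (a :- (r :+ u)) :* P) :* p := u :* (P :* p)) refl
      where open +-*-Solver
    difference : ∀ s → s ≡ ι r + ι u → ((a - ι r) * P - (a - s) * P) * ι p ≡ ι u
    difference s refl = begin
      ((a - ι r) * P - (a - (ι r + ι u)) * P) * ι p ≡⟨ factor a (ι r) (ι u) P (ι p) ⟩
      ι u * (P * ι p)                               ≡⟨ cong (ι u *_) P*p≡1 ⟩
      ι u * 1ℚ                                      ≡⟨ *-identityʳ (ι u) ⟩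
      ι u                                           ∎
    p∣u : ∀ x y → x ∈ ℤₚ → y ∈ ℤₚ → (x - y) * ι p ≡ ι u → p ∣ u
    p∣u x y x∈ y∈ eq =
      [ (λ p∣u → p∣u) , (λ p∣↧ → contradiction p∣↧ (-∈ℤₚ {x} {y} x∈ y∈)) ]′
        (euclidsLemma u (↧ₙ (x - y)) pr
          (subst (p ∣_) (ℤ.abs-* (+ u) (↧ (x - y)))
            (ℤ.∣⇒∣ᵤ (ℤ.divides (↥ (x - y)) (sym (clear (x - y) (+ u) p eq))))))
    small : ∀ u → u ℕ.< p → p ∣ u → u ≡ 0
    small zero    _   _   = refl
    small (suc _) u<p p∣u = contradiction (∣⇒≤ p∣u) (ℕ.<⇒≱ u<p)

  residue-unique-≤ : ∀ a r s → a ≡ ι r [mod-p^ 1 ] → a ≡ ι s [mod-p^ 1 ] →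
                     s ℕ.< p → r ℕ.≤ s → r ≡ s
  residue-unique-≤ a r s a≡r a≡s s<p r≤s = ℕ.≤-antisym r≤s (ℕ.m∸n≡0⇒m≤n s∸r≡0)
    where
    r+[s∸r]≡s = ℕ.m+[n∸m]≡n r≤s
    s∸r≡0 : s ℕ.∸ r ≡ 0
    s∸r≡0 = residue-unique-+ a r (s ℕ.∸ r) (1/p^ 1) 1/p^1*p≡1
      (_≡_[mod-p^_].quotient a≡r)
      (subst (λ t → (a - ι t) * (1/p^ 1) ∈ ℤₚ) (sym r+[s∸r]≡s) (_≡_[mod-p^_].quotient a≡s))
      (subst (ℕ._< p) (sym r+[s∸r]≡s) s<p)

  residue-exists! : ∀ a → a ∈ ℤₚ → ∃! _≡_ λ r → r ℕ.< p × a ≡ ι r [mod-p^ 1 ]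
  residue-exists! a a∈ = unique (residue-exists a a∈)
    where
    unique : (∃ λ r → r ℕ.< p × a ≡ ι r [mod-p^ 1 ]) → ∃! _≡_ λ r → r ℕ.< p × a ≡ ι r [mod-p^ 1 ]
    unique (r , r<p , a≡r) = r , (r<p , a≡r) , r≡
      where
      r≡ : ∀ {s} → s ℕ.< p × a ≡ ι s [mod-p^ 1 ] → r ≡ s
      r≡ {s} (s<p , a≡s) with ℕ.≤-total r s
      ... | inj₁ r≤s = residue-unique-≤ a r s a≡r a≡s s<p r≤s
      ... | inj₂ s≤r = sym (residue-unique-≤ a s r a≡s a≡r r<p s≤r)

  -- The representative ⟨a⟩ₚ ∈ {0, …, p - 1} of a modulo p.
  residue : ∀ a → a ∈ ℤₚ → ℕ
  residue a a∈ℤₚ = proj₁ (residue-exists! a a∈ℤₚ)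

  -- a′ = (a - ⟨a⟩ₚ) / p
  residueQuotient : ∀ a → a ∈ ℤₚ → ℚ
  residueQuotient a a∈ℤₚ = (a - ι (residue a a∈ℤₚ)) * (+ 1 / p)

  -- Makes the division by 15 (a + 1) meaningful.
  15[a+1]≢0 : ∀ a → ¬ (a ≡ - 1ℚ [mod-p^ 1 ]) → NonZero (ι 15 * (a + 1ℚ))
  15[a+1]≢0 a a≢-1 = ≢-nonZero λ eq → a≢-1 (subst (_≡ - 1ℚ [mod-p^ 1 ]) (sym (a≡-1 eq)) -1≡-1)
    where
    open ≡-Reasoning
    open +-*-Solver
    a≡-1 : ι 15 * (a + 1ℚ) ≡ 0ℚ → a ≡ - 1ℚ
    a≡-1 eq = begin
      a                                        ≡⟨ solve 1 (λ a → a := con (+ 1 / 15) :* (con (ι 15) :* (a :+ con 1ℚ)) :- con 1ℚ) refl a ⟩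
      (+ 1 / 15) * (ι 15 * (a + 1ℚ)) - 1ℚ      ≡⟨ cong (λ u → (+ 1 / 15) * u - 1ℚ) eq ⟩
      - 1ℚ                                     ∎
    -1≡-1 : - 1ℚ ≡ - 1ℚ [mod-p^ 1 ]
    -1≡-1 = congruent p∤1 p∤1 (subst (_∈ ℤₚ) (sym (*-zeroˡ (1/p^ 1))) p∤1)

{-# OPTIONS --safe #-}

-- Put wₖ = C(a+1, k) C(-1-a, k) C(2k, k) / 4ᵏ. Up to the factor a + 1, the summands of S(a) and
-- S(a+1) are (a+1-k) wₖ and (a+1+k) wₖ, and with these Gosper's algorithm gives
--   (a+1) (15 Σ_{k<n} k³ tₖ - α S_n(a) + β S_n(a+1)) = n³ Q(n) wₙ,
-- where tₖ is the summand of S(a) and Q is a quadratic polynomial with constant term -2γ. At n = p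
-- this leaves wₚ modulo p, which follows from C(r + pz, p) ≡ z (mod p) for 0 ≤ r < p, applied to all
-- three factors, as C(2k, k) / 4ᵏ = (-1)ᵏ C(-1/2, k). The result is wₚ ≡ -a′ (a′ + 1) / 2 (mod p).
module Submission where

open import Defs
open import Data.Integer.Base as ℤ using (+_; -[1+_])
import Data.Integer.Divisibility.Signed as ℤ
import Data.Integer.Properties as ℤ
open import Data.Nat.Base as ℕ using (ℕ; zero; suc; _!)
open import Data.Nat.Combinatorics using (_C_; nCk≡n!/k![n-k]!; k![n∸k]!∣n!)
open import Data.Nat.Divisibility using (_∣_; ∣⇒≤; divides)
import Data.Nat.DivMod as ℕ
open import Data.Nat.Primality using (Prime; prime⇒nonZero; prime⇒irreducible; euclidsLemma)
import Data.Nat.Properties as ℕ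
open import Data.Product.Base using (_×_; _,_; proj₁; proj₂; ∃)
open import Data.Rational.Base using (ℚ; 0ℚ; 1ℚ; ½; -½; -_; _+_; _-_; _*_; _÷_; _/_)
open import Data.Rational.Literals using (fromℤ)
open import Data.Rational.Properties
open import Data.Rational.Solver using (module +-*-Solver)
open import Data.Sum.Base using (_⊎_; inj₁; inj₂; [_,_]′)
open import Relation.Binary.PropositionalEquality
open import Relation.Nullary.Negation using (¬_; contradiction)
open import Relation.Unary using (_∈_)

open +-*-Solver
open ≡-Reasoning

-- Naturals and their reciprocals in ℚ.

ι-suc : ∀ n → ι (suc n) ≡ 1ℚ + ι n
ι-suc n = fromℤ-+ (+ 1) (+ n)

ι-+ : ∀ m n → ι (m ℕ.+ n) ≡ ι m + ι n
ι-+ m n = fromℤ-+ (+ m) (+ n)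

ι-* : ∀ m n → ι (m ℕ.* n) ≡ ι m * ι n
ι-* m n = trans (cong fromℤ (ℤ.pos-* m n)) (fromℤ-* (+ m) (+ n))

-- Reciprocals are compared by multiplying through, so that no later identity has to unfold the
-- normalisation inside `_/_`.
1/-unique : ∀ n .{{_ : ℕ.NonZero n}} {x} → x * ι n ≡ 1ℚ → x ≡ + 1 / n
1/-unique n {x} eq = begin
  x                          ≡⟨ *-identityʳ x ⟨
  x * 1ℚ                     ≡⟨ cong (x *_) (/-*-cancel n) ⟨
  x * ((+ 1 / n) * ι n)      ≡⟨ solve 3 (λ x r n → x :* (r :* n) := r :* (x :* n)) refl x (+ 1 / n) (ι n) ⟩
  (+ 1 / n) * (x * ι n)      ≡⟨ cong ((+ 1 / n) *_) eq ⟩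
  (+ 1 / n) * 1ℚ             ≡⟨ *-identityʳ _ ⟩
  + 1 / n                    ∎

1/-*-cancelˡ : ∀ m n .{{_ : ℕ.NonZero n}} .{{_ : ℕ.NonZero (m ℕ.* n)}} →
               (+ 1 / (m ℕ.* n)) * ι m ≡ + 1 / n
1/-*-cancelˡ m n = 1/-unique n (begin
  (+ 1 / (m ℕ.* n)) * ι m * ι n      ≡⟨ *-assoc (+ 1 / (m ℕ.* n)) (ι m) (ι n) ⟩
  (+ 1 / (m ℕ.* n)) * (ι m * ι n)    ≡⟨ cong ((+ 1 / (m ℕ.* n)) *_) (ι-* m n) ⟨
  (+ 1 / (m ℕ.* n)) * ι (m ℕ.* n)    ≡⟨ /-*-cancel (m ℕ.* n) ⟩
  1ℚ                                 ∎)

-- Definitionally the reciprocal inside `binom`; under a name it can serve as an atom for the ring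
-- solver.
1/[_]! : ℕ → ℚ
1/[ k ]! = + 1 / k !
  where instance _ = k ℕ.!≢0

1/4^[_] : ℕ → ℚ
1/4^[ k ] = + 1 / (4 ℕ.^ k)
  where instance _ = ℕ.m^n≢0 4 k

1/!-cancel : ∀ k → 1/[ k ]! * ι (k !) ≡ 1ℚ
1/!-cancel k = /-*-cancel (k !)
  where instance _ = k ℕ.!≢0

1/!-suc : ∀ k → 1/[ suc k ]! * ι (suc k) ≡ 1/[ k ]!
1/!-suc k = 1/-*-cancelˡ (suc k) (k !)
  where instance
    _ = k ℕ.!≢0
    _ = suc k ℕ.!≢0

1/4^-suc : ∀ k → 1/4^[ suc k ] * ι 4 ≡ 1/4^[ k ]
1/4^-suc k = 1/-*-cancelˡ 4 (4 ℕ.^ k)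
  where instance
    _ = ℕ.m^n≢0 4 k
    _ = ℕ.m^n≢0 4 (suc k)

-- Falling factorials and binomial coefficients with rational upper index.

-- The recursion of `falling` exposes the last factor. Exposing the first one instead is what a
-- shift of x by 1 requires.
falling-head : ∀ x n → falling x (suc n) ≡ x * falling (x - 1ℚ) n
falling-head x zero    = solve 1 (λ x → con 1ℚ :* (x :- con 0ℚ) := x :* con 1ℚ) refl x
falling-head x (suc n) = begin
  falling x (suc n) * (x - ι (suc n))
    ≡⟨ cong₂ (λ u v → u * (x - v)) (falling-head x n) (ι-suc n) ⟩
  x * falling (x - 1ℚ) n * (x - (1ℚ + ι n))
    ≡⟨ solve 3 (λ x f n → x :* f :* (x :- (con 1ℚ :+ n)) := x :* (f :* (x :- con 1ℚ :- n))) refl x (falling (x - 1ℚ) n) (ι n) ⟩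
  x * (falling (x - 1ℚ) n * (x - 1ℚ - ι n)) ∎

falling-+ : ∀ x m n → falling x (m ℕ.+ n) ≡ falling x m * falling (x - ι m) n
falling-+ x m zero    = trans (cong (falling x) (ℕ.+-identityʳ m)) (sym (*-identityʳ _))
falling-+ x m (suc n) = begin
  falling x (m ℕ.+ suc n)
    ≡⟨ cong (falling x) (ℕ.+-suc m n) ⟩
  falling x (m ℕ.+ n) * (x - ι (m ℕ.+ n))
    ≡⟨ cong₂ (λ u v → u * (x - v)) (falling-+ x m n) (ι-+ m n) ⟩
  falling x m * falling (x - ι m) n * (x - (ι m + ι n))
    ≡⟨ solve 5 (λ x m n f g → f :* g :* (x :- (m :+ n)) := f :* (g :* (x :- m :- n))) refl x (ι m) (ι n) (falling x m) (falling (x - ι m) n) ⟩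
  falling x m * (falling (x - ι m) n * (x - ι m - ι n)) ∎

-- The quotient (n + r)! / r! in multiplied-out form. The induction removes the first factor n + r,
-- which leaves r unchanged.
falling-! : ∀ n r → falling (ι (n ℕ.+ r)) n * ι (r !) ≡ ι ((n ℕ.+ r) !)
falling-! zero    r = *-identityˡ _
falling-! (suc n) r = begin
  falling (ι (suc s)) (suc n) * ι (r !)
    ≡⟨ cong (_* ι (r !)) (falling-head (ι (suc s)) n) ⟩
  ι (suc s) * falling (ι (suc s) - 1ℚ) n * ι (r !)
    ≡⟨ cong (λ u → ι (suc s) * falling u n * ι (r !)) pred-s ⟩
  ι (suc s) * falling (ι s) n * ι (r !)
    ≡⟨ *-assoc (ι (suc s)) (falling (ι s) n) (ι (r !)) ⟩
  ι (suc s) * (falling (ι s) n * ι (r !))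
    ≡⟨ cong (ι (suc s) *_) (falling-! n r) ⟩
  ι (suc s) * ι (s !)
    ≡⟨ ι-* (suc s) (s !) ⟨
  ι (suc s !) ∎
  where
  s = n ℕ.+ r
  pred-s : ι (suc s) - 1ℚ ≡ ι s
  pred-s = trans (cong (_- 1ℚ) (ι-suc s))
    (solve 1 (λ s → con 1ℚ :+ s :- con 1ℚ := s) refl (ι s))

falling-n-n : ∀ n → falling (ι n) n ≡ ι (n !)
falling-n-n n = begin
  falling (ι n) n                  ≡⟨ cong (λ m → falling (ι m) n) (ℕ.+-identityʳ n) ⟨
  falling (ι (n ℕ.+ 0)) n          ≡⟨ *-identityʳ _ ⟨
  falling (ι (n ℕ.+ 0)) n * 1ℚ     ≡⟨ falling-! n 0 ⟩
  ι ((n ℕ.+ 0) !)                  ≡⟨ cong (λ m → ι (m !)) (ℕ.+-identityʳ n) ⟩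
  ι (n !)                          ∎

binom-suc : ∀ x k → binom x (suc k) * ι (suc k) ≡ binom x k * (x - ι k)
binom-suc x k = begin
  falling x k * (x - ι k) * 1/[ suc k ]! * ι (suc k)
    ≡⟨ solve 4 (λ f d r s → f :* d :* r :* s := f :* (r :* s) :* d) refl (falling x k) (x - ι k) (1/[ suc k ]!) (ι (suc k)) ⟩
  falling x k * (1/[ suc k ]! * ι (suc k)) * (x - ι k)
    ≡⟨ cong (λ u → falling x k * u * (x - ι k)) (1/!-suc k) ⟩
  binom x k * (x - ι k) ∎

-- Both sides are the falling factorial of x with k + 1 factors, divided by k!, once with the last
-- and once with the first factor split off. A separate `y` lets callers use a simplified form of x
-- - 1, such as a for (a + 1) - 1.
binom-absorb : ∀ x y k → x - 1ℚ ≡ y → binom x k * (x - ι k) ≡ x * binom y k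
binom-absorb x _ k refl = begin
  falling x k * 1/[ k ]! * (x - ι k)
    ≡⟨ solve 3 (λ f r d → f :* r :* d := f :* d :* r) refl (falling x k) (1/[ k ]!) (x - ι k) ⟩
  falling x (suc k) * 1/[ k ]!
    ≡⟨ cong (_* 1/[ k ]!) (falling-head x k) ⟩
  x * falling (x - 1ℚ) k * 1/[ k ]!
    ≡⟨ *-assoc x (falling (x - 1ℚ) k) (1/[ k ]!) ⟩
  x * binom (x - 1ℚ) k ∎

-- The factor C(2k, k) / 4ᵏ.

central : ℕ → ℚ
central k = ι ((2 ℕ.* k) C k) * 1/4^[ k ]

2k∸k≡k : ∀ k → 2 ℕ.* k ℕ.∸ k ≡ k
2k∸k≡k k = trans (ℕ.m+n∸m≡n k (k ℕ.+ 0)) (ℕ.+-identityʳ k)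

centralC-! : ∀ k → ((2 ℕ.* k) C k) ℕ.* (k ! ℕ.* k !) ≡ (2 ℕ.* k) !
centralC-! k = subst (λ j → ((2 ℕ.* k) C k) ℕ.* (k ! ℕ.* j !) ≡ (2 ℕ.* k) !) (2k∸k≡k k)
  -- The library formula is a truncated division; it is exact because k! (2k - k)! divides (2k)!.
  (trans (cong (λ c → c ℕ.* (k ! ℕ.* (2 ℕ.* k ℕ.∸ k) !)) (nCk≡n!/k![n-k]! k≤2k)) (ℕ.m/n*n≡m (k![n∸k]!∣n! k≤2k)))
  where
  k≤2k = ℕ.m≤m+n k (k ℕ.+ 0)
  instance _ = k ℕ.!* (2 ℕ.* k ℕ.∸ k) !≢0

ι-centralC : ∀ k → ι ((2 ℕ.* k) C k) ≡ ι ((2 ℕ.* k) !) * 1/[ k ]! * 1/[ k ]!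
ι-centralC k = sym (begin
  ι ((2 ℕ.* k) !) * 1/[ k ]! * 1/[ k ]!
    ≡⟨ cong (λ u → u * 1/[ k ]! * 1/[ k ]!) (begin
         ι ((2 ℕ.* k) !)                  ≡⟨ cong ι (centralC-! k) ⟨
         ι (c ℕ.* (k ! ℕ.* k !))          ≡⟨ ι-* c (k ! ℕ.* k !) ⟩
         ι c * ι (k ! ℕ.* k !)            ≡⟨ cong (ι c *_) (ι-* (k !) (k !)) ⟩
         ι c * (ι (k !) * ι (k !))        ∎) ⟩
  ι c * (ι (k !) * ι (k !)) * 1/[ k ]! * 1/[ k ]!
    ≡⟨ solve 3 (λ c f r → c :* (f :* f) :* r :* r := c :* ((r :* f) :* (r :* f))) refl (ι c) (ι (k !)) (1/[ k ]!) ⟩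
  ι c * ((1/[ k ]! * ι (k !)) * (1/[ k ]! * ι (k !)))
    ≡⟨ cong (λ u → ι c * (u * u)) (1/!-cancel k) ⟩
  ι c * (1ℚ * 1ℚ)
    ≡⟨ *-identityʳ (ι c) ⟩
  ι c ∎)
  where c = (2 ℕ.* k) C k

-- From k to k + 1 the left side gains (2k + 2)(2k + 1) / (4 (k + 1)) = k + ½, the negative of the
-- next factor -½ - k on the right.
central-falling : ∀ k → ι ((2 ℕ.* k) !) * 1/[ k ]! * 1/4^[ k ] ≡ (- 1ℚ) ^ℚ k * falling -½ k
central-falling zero    = refl
central-falling (suc k) = begin
  ι ((2 ℕ.* suc k) !) * F′ * q′
    ≡⟨ cong₂ (λ u v → u * F′ * v) double-! q′≡ ⟩
  (ι 2 * s * (1ℚ + ι 2 * ι k) * f) * F′ * (q * (+ 1 / 4))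
    ≡⟨ solve 5 (λ s k f F q → (con (ι 2) :* s :* (con 1ℚ :+ con (ι 2) :* k) :* f) :* F :* (q :* con (+ 1 / 4))
                  := (f :* (F :* s) :* q) :* (con ½ :+ k)) refl s (ι k) f F′ q ⟩
  (f * (F′ * s) * q) * (½ + ι k)
    ≡⟨ cong (λ u → (f * u * q) * (½ + ι k)) (1/!-suc k) ⟩
  (f * 1/[ k ]! * q) * (½ + ι k)
    ≡⟨ cong (_* (½ + ι k)) (central-falling k) ⟩
  (- 1ℚ) ^ℚ k * falling -½ k * (½ + ι k)
    ≡⟨ solve 3 (λ g l k → g :* l :* (con ½ :+ k) := con (- 1ℚ) :* g :* (l :* (con -½ :- k))) refl ((- 1ℚ) ^ℚ k) (falling -½ k) (ι k) ⟩
  (- 1ℚ) ^ℚ suc k * falling -½ (suc k) ∎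
  where
  s  = ι (suc k)
  f  = ι ((2 ℕ.* k) !)
  F′ = 1/[ suc k ]!
  q  = 1/4^[ k ]
  q′ = 1/4^[ suc k ]
  q′≡ : q′ ≡ q * (+ 1 / 4)
  q′≡ = trans (solve 1 (λ q → q := q :* con (ι 4) :* con (+ 1 / 4)) refl q′) (cong (_* (+ 1 / 4)) (1/4^-suc k))
  2+2k : ∀ k → 2 ℕ.* suc k ≡ suc (suc (2 ℕ.* k))
  2+2k k = ℕ.*-suc 2 k
  double-! : ι ((2 ℕ.* suc k) !) ≡ ι 2 * s * (1ℚ + ι 2 * ι k) * f
  double-! = begin
    ι ((2 ℕ.* suc k) !)
      ≡⟨ cong (λ n → ι (n !)) (2+2k k) ⟩
    ι (suc (suc (2 ℕ.* k)) ℕ.* (suc (2 ℕ.* k) ℕ.* (2 ℕ.* k) !))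
      ≡⟨ trans (ι-* (suc (suc (2 ℕ.* k))) (suc (2 ℕ.* k) ℕ.* (2 ℕ.* k) !))
           (cong (ι (suc (suc (2 ℕ.* k))) *_) (ι-* (suc (2 ℕ.* k)) ((2 ℕ.* k) !))) ⟩
    ι (suc (suc (2 ℕ.* k))) * (ι (suc (2 ℕ.* k)) * f)
      ≡⟨ cong₂ (λ u v → u * (v * f)) (trans (cong ι (sym (2+2k k))) (ι-* 2 (suc k)))
           (trans (ι-suc (2 ℕ.* k)) (cong (λ u → 1ℚ + u) (ι-* 2 k))) ⟩
    ι 2 * s * ((1ℚ + ι 2 * ι k) * f)
      ≡⟨ *-assoc (ι 2 * s) (1ℚ + ι 2 * ι k) f ⟨
    ι 2 * s * (1ℚ + ι 2 * ι k) * f ∎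

-- With this, both the recurrence of `central` and its value modulo p at k = p become facts about
-- binomial coefficients.
central≡binom : ∀ k → central k ≡ (- 1ℚ) ^ℚ k * binom -½ k
central≡binom k = begin
  ι ((2 ℕ.* k) C k) * 1/4^[ k ]
    ≡⟨ cong (_* 1/4^[ k ]) (ι-centralC k) ⟩
  ι ((2 ℕ.* k) !) * 1/[ k ]! * 1/[ k ]! * 1/4^[ k ]
    ≡⟨ solve 3 (λ f r q → f :* r :* r :* q := f :* r :* q :* r) refl (ι ((2 ℕ.* k) !)) (1/[ k ]!) (1/4^[ k ]) ⟩
  ι ((2 ℕ.* k) !) * 1/[ k ]! * 1/4^[ k ] * 1/[ k ]!
    ≡⟨ cong (_* 1/[ k ]!) (central-falling k) ⟩
  (- 1ℚ) ^ℚ k * falling -½ k * 1/[ k ]!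
    ≡⟨ *-assoc ((- 1ℚ) ^ℚ k) (falling -½ k) (1/[ k ]!) ⟩
  (- 1ℚ) ^ℚ k * binom -½ k ∎

central-suc : ∀ k → central (suc k) * ι (suc k) ≡ central k * (½ + ι k)
central-suc k = begin
  central (suc k) * ι (suc k)
    ≡⟨ cong (_* ι (suc k)) (central≡binom (suc k)) ⟩
  - 1ℚ * (- 1ℚ) ^ℚ k * binom -½ (suc k) * ι (suc k)
    ≡⟨ *-assoc (- 1ℚ * (- 1ℚ) ^ℚ k) (binom -½ (suc k)) (ι (suc k)) ⟩
  - 1ℚ * (- 1ℚ) ^ℚ k * (binom -½ (suc k) * ι (suc k))
    ≡⟨ cong (- 1ℚ * (- 1ℚ) ^ℚ k *_) (binom-suc -½ k) ⟩
  - 1ℚ * (- 1ℚ) ^ℚ k * (binom -½ k * (-½ - ι k))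
    ≡⟨ solve 3 (λ g b k → con (- 1ℚ) :* g :* (b :* (con -½ :- k)) := g :* b :* (con ½ :+ k)) refl ((- 1ℚ) ^ℚ k) (binom -½ k) (ι k) ⟩
  (- 1ℚ) ^ℚ k * binom -½ k * (½ + ι k)
    ≡⟨ cong (_* (½ + ι k)) (central≡binom k) ⟨
  central k * (½ + ι k) ∎

-- The weight shared by the summands of S(a) and S(a+1).

weight : ℚ → ℕ → ℚ
weight a k = binom (a + 1ℚ) k * binom (- 1ℚ - a) k * central k

-- The hypergeometric term ratio, free of division: each of the three factors of the weight absorbs
-- one k + 1.
weight-suc : ∀ a k → let s = ι (suc k) in
  s * s * s * weight a (suc k) ≡ (a + 1ℚ - ι k) * (- 1ℚ - a - ι k) * (½ + ι k) * weight a k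
weight-suc a k = begin
  s * s * s * (x′ * y′ * c′)
    ≡⟨ solve 4 (λ s x y c → s :* s :* s :* (x :* y :* c) := (x :* s) :* (y :* s) :* (c :* s)) refl s x′ y′ c′ ⟩
  (x′ * s) * (y′ * s) * (c′ * s)
    ≡⟨ cong₂ _*_ (cong₂ _*_ (binom-suc (a + 1ℚ) k) (binom-suc (- 1ℚ - a) k)) (central-suc k) ⟩
  (x * u) * (y * v) * (c * t)
    ≡⟨ solve 6 (λ x y c u v t → (x :* u) :* (y :* v) :* (c :* t) := u :* v :* t :* (x :* y :* c)) refl x y c u v t ⟩
  u * v * t * (x * y * c) ∎
  where
  s = ι (suc k)
  x′ = binom (a + 1ℚ) (suc k)
  y′ = binom (- 1ℚ - a) (suc k)
  c′ = central (suc k)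
  x = binom (a + 1ℚ) k
  y = binom (- 1ℚ - a) k
  c = central k
  u = a + 1ℚ - ι k
  v = - 1ℚ - a - ι k
  t = ½ + ι k

summand-central : ∀ a k → summand a k ≡ binom a k * binom (- 1ℚ - a) k * central k
summand-central a k = *-assoc (binom a k * binom (- 1ℚ - a) k) (ι ((2 ℕ.* k) C k)) 1/4^[ k ]

-- Absorption in the first binomial coefficient: (a + 1) C(a, k) = (a + 1 - k) C(a + 1, k).
summand-weight : ∀ a k → (a + 1ℚ) * summand a k ≡ weight a k * (a + 1ℚ - ι k)
summand-weight a k = begin
  b * summand a k                 ≡⟨ cong (b *_) (summand-central a k) ⟩
  b * (binom a k * y * c)         ≡⟨ solve 4 (λ b x y c → b :* (x :* y :* c) := b :* x :* y :* c) refl b (binom a k) y c ⟩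
  b * binom a k * y * c           ≡⟨ cong (λ u → u * y * c) (binom-absorb b a k (solve 1 (λ a → a :+ con 1ℚ :- con 1ℚ := a) refl a)) ⟨
  binom b k * (b - ι k) * y * c   ≡⟨ solve 4 (λ x y c d → x :* d :* y :* c := x :* y :* c :* d) refl (binom b k) y c (b - ι k) ⟩
  weight a k * (b - ι k)          ∎
  where
  b = a + 1ℚ
  y = binom (- 1ℚ - a) k
  c = central k

-- Absorption in the second binomial coefficient, whose upper index falls from -1 - a to -1 - (a +
-- 1). The signs in a + 1 = -(-1 - a) and -1 - a - k = -(a + 1 + k) cancel.
summand-weight′ : ∀ a k → (a + 1ℚ) * summand (a + 1ℚ) k ≡ weight a k * (a + 1ℚ + ι k)
summand-weight′ a k = begin
  b * summand b k
    ≡⟨ cong (b *_) (summand-central b k) ⟩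
  b * (x * binom (- 1ℚ - b) k * c)
    ≡⟨ solve 4 (λ a x y c → (a :+ con 1ℚ) :* (x :* y :* c) := con (- 1ℚ) :* x :* ((con (- 1ℚ) :- a) :* y) :* c) refl a x (binom (- 1ℚ - b) k) c ⟩
  - 1ℚ * x * ((- 1ℚ - a) * binom (- 1ℚ - b) k) * c
    ≡⟨ cong (λ u → - 1ℚ * x * u * c) (binom-absorb (- 1ℚ - a) (- 1ℚ - b) k
         (solve 1 (λ a → con (- 1ℚ) :- a :- con 1ℚ := con (- 1ℚ) :- (a :+ con 1ℚ)) refl a)) ⟨
  - 1ℚ * x * (binom (- 1ℚ - a) k * (- 1ℚ - a - ι k)) * c
    ≡⟨ solve 5 (λ a k x y c → con (- 1ℚ) :* x :* (y :* (con (- 1ℚ) :- a :- k)) :* c := x :* y :* c :* (a :+ con 1ℚ :+ k)) refl a (ι k) x (binom (- 1ℚ - a) k) c ⟩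
  weight a k * (b + ι k) ∎
  where
  b = a + 1ℚ
  x = binom b k
  c = central k

-- Gosper summation.

-- `∑` recurses on the first term; induction on the number of terms needs the last one.
∑-suc : ∀ n f → ∑ (suc n) f ≡ ∑ n f + f n
∑-suc zero    f = +-comm (f 0) 0ℚ
∑-suc (suc n) f = trans (cong (λ u → f 0 + u) (∑-suc n (λ k → f (suc k)))) (sym (+-assoc (f 0) (∑ n (λ k → f (suc k))) (f (suc n))))

-- 15 times the coefficients of S_p(a) and - S_p(a+1), and 15 (a+1) times that of a′ (a′+1) p³.
α β γ : ℚ → ℚ
α a = a ^ℚ 2 * (a + 1ℚ) ^ℚ 2 * (ι 2 * a + 1ℚ) ^ℚ 2
β a = (a + 1ℚ) ^ℚ 2 * (ι 4 * a ^ℚ 2 * (a + 1ℚ) ^ℚ 2 - a * (a + 1ℚ) + 1ℚ)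
γ a = ι 4 * a ^ℚ 4 + ι 6 * a ^ℚ 3 - a ^ℚ 2 + a + ι 5

-- The polynomial Q found by Gosper's algorithm, written as its constant term plus a multiple of k.
certificate : ℚ → ℚ → ℚ
certificate a k = - ι 2 * γ a + k * (ι 14 + ι 2 * a - ι 4 * a ^ℚ 2 - ι 6 * k)

-- One telescoping step divided by wₖ: boundary term at k plus the k-th increment equals boundary
-- term at k + 1, where (k + 1)³ wₖ₊₁ / wₖ has been replaced by the ratio from `weight-suc`.
certificate-identity : ∀ a k →
  k * k * k * certificate a k + ((ι 15 * (k ^ℚ 3) - α a) * (a + 1ℚ - k) + β a * (a + 1ℚ + k))
    ≡ certificate a (1ℚ + k) * ((a + 1ℚ - k) * (- 1ℚ - a - k) * (½ + k))
certificate-identity = solve 2 (λ a k →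
  -- Squares and cubes end in a factor 1 because `_^ℚ_` unfolds to such products.
  let sq   = λ x → x :* (x :* con 1ℚ)
      cube = λ x → x :* sq x
      b = a :+ con 1ℚ
      A = sq a :* sq b :* sq (con (ι 2) :* a :+ con 1ℚ)
      B = sq b :* (con (ι 4) :* sq a :* sq b :- a :* b :+ con 1ℚ)
      C = con (ι 4) :* (a :* cube a) :+ con (ι 6) :* cube a :- sq a :+ a :+ con (ι 5)
      Q = λ x → con (- ι 2) :* C :+ x :* (con (ι 14) :+ con (ι 2) :* a :- con (ι 4) :* sq a :- con (ι 6) :* x)
  in ((k :* k) :* k) :* Q k :+ ((con (ι 15) :* cube k :- A) :* (b :- k) :+ B :* (b :+ k))
       := Q (con 1ℚ :+ k) :* (((b :- k) :* (con (- 1ℚ) :- a :- k)) :* (con ½ :+ k))) refl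

-- Induction on n: at 0 the sums are empty and the boundary term has the factor n. In the step, the
-- new summands become multiples of wₙ, `certificate-identity` combines them with the old boundary
-- term, and `weight-suc` turns wₙ into wₙ₊₁.
telescope : ∀ a n →
  (a + 1ℚ) * (ι 15 * ∑ n (λ k → ι k ^ℚ 3 * summand a k) - α a * S n a + β a * S n (a + 1ℚ))
    ≡ ι n * ι n * ι n * certificate a (ι n) * weight a n
telescope a zero    = trans
  (solve 3 (λ a x y → (a :+ con 1ℚ) :* (con (ι 15) :* con 0ℚ :- x :* con 0ℚ :+ y :* con 0ℚ) := con 0ℚ) refl a (α a) (β a))
  (solve 2 (λ x y → con 0ℚ := con (ι 0) :* con (ι 0) :* con (ι 0) :* x :* y) refl (certificate a (ι 0)) (weight a 0))
telescope a (suc n) = begin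
  b * (ι 15 * ∑ (suc n) f - A * S (suc n) a + B * S (suc n) b)
    ≡⟨ cong₂ (λ u v → b * (u + B * v))
         (cong₂ (λ u v → ι 15 * u - A * v) (∑-suc n f) (∑-suc n (summand a))) (∑-suc n (summand b)) ⟩
  b * (ι 15 * (σ + k ^ℚ 3 * t) - A * (S n a + t) + B * (S n b + t′))
    ≡⟨ solve 9 (λ b σ S S′ A B K t t′ → b :* (con (ι 15) :* (σ :+ K :* t) :- A :* (S :+ t) :+ B :* (S′ :+ t′))
         := b :* (con (ι 15) :* σ :- A :* S :+ B :* S′) :+ ((con (ι 15) :* K :- A) :* (b :* t) :+ B :* (b :* t′)))
         refl b σ (S n a) (S n b) A B (k ^ℚ 3) t t′ ⟩
  b * (ι 15 * σ - A * S n a + B * S n b) + ((ι 15 * (k ^ℚ 3) - A) * (b * t) + B * (b * t′))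
    ≡⟨ cong₂ _+_ (telescope a n)
         (cong₂ (λ u v → (ι 15 * (k ^ℚ 3) - A) * u + B * v) (summand-weight a n) (summand-weight′ a n)) ⟩
  k * k * k * Q * w + ((ι 15 * (k ^ℚ 3) - A) * (w * (b - k)) + B * (w * (b + k)))
    ≡⟨ solve 6 (λ K w D u B v → K :* w :+ (D :* (w :* u) :+ B :* (w :* v)) := (K :+ (D :* u :+ B :* v)) :* w)
         refl (k * k * k * Q) w (ι 15 * (k ^ℚ 3) - A) (b - k) B (b + k) ⟩
  (k * k * k * Q + ((ι 15 * (k ^ℚ 3) - A) * (b - k) + B * (b + k))) * w
    ≡⟨ cong (_* w) (certificate-identity a k) ⟩
  certificate a (1ℚ + k) * ((b - k) * (- 1ℚ - a - k) * (½ + k)) * w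
    ≡⟨ *-assoc (certificate a (1ℚ + k)) ((b - k) * (- 1ℚ - a - k) * (½ + k)) w ⟩
  certificate a (1ℚ + k) * ((b - k) * (- 1ℚ - a - k) * (½ + k) * w)
    ≡⟨ cong₂ (λ u v → certificate a u * v) (ι-suc n) (weight-suc a n) ⟨
  certificate a s * (s * s * s * weight a (suc n))
    ≡⟨ solve 3 (λ q s w → q :* (s :* w) := s :* q :* w) refl (certificate a s) (s * s * s) (weight a (suc n)) ⟩
  s * s * s * certificate a s * weight a (suc n) ∎
  where
  b = a + 1ℚ
  k = ι n
  s = ι (suc n)
  f : ℕ → ℚ
  f k = ι k ^ℚ 3 * summand a k
  σ = ∑ n f
  A = α a
  B = β a
  t = summand a n
  t′ = summand b n
  Q = certificate a k
  w = weight a n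

-- Powers and parity.

ι-^ : ∀ m n → ι (m ℕ.^ n) ≡ ι m ^ℚ n
ι-^ m zero    = refl
ι-^ m (suc n) = trans (ι-* m (m ℕ.^ n)) (cong (ι m *_) (ι-^ m n))

even-or-odd : ∀ n → ∃ λ h → n ≡ h ℕ.+ h ⊎ n ≡ suc (h ℕ.+ h)
even-or-odd zero = 0 , inj₁ refl
even-or-odd (suc n) with even-or-odd n
... | h , inj₁ refl = h , inj₂ refl
... | h , inj₂ refl = suc h , inj₁ (cong suc (sym (ℕ.+-suc h h)))

-1^even : ∀ h → (- 1ℚ) ^ℚ (h ℕ.+ h) ≡ 1ℚ
-1^even zero    = refl
-1^even (suc h) = begin
  - 1ℚ * (- 1ℚ) ^ℚ (h ℕ.+ suc h)        ≡⟨ cong (λ n → - 1ℚ * (- 1ℚ) ^ℚ n) (ℕ.+-suc h h) ⟩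
  - 1ℚ * (- 1ℚ * (- 1ℚ) ^ℚ (h ℕ.+ h))   ≡⟨ cong (λ u → - 1ℚ * (- 1ℚ * u)) (-1^even h) ⟩
  - 1ℚ * (- 1ℚ * 1ℚ)                    ≡⟨⟩
  1ℚ                                    ∎

-- Closure properties of ℤₚ.

module _ (p : ℕ) (pr : Prime p) where
  open Localization p pr

  private instance
    p≢0 : ℕ.NonZero p
    p≢0 = prime⇒nonZero pr

  +∈ : ∀ {x y} → x ∈ ℤₚ → y ∈ ℤₚ → x + y ∈ ℤₚ
  +∈ {x} {y} x∈ y∈ = subst (_∈ ℤₚ)
    (solve 2 (λ x y → x :- (con 0ℚ :- y) := x :+ y) refl x y)
    -- The denominator of `0ℚ` computes to 1, so `p∤1` proves its membership; the same proof serves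
    -- for all integers below.
    (-∈ℤₚ {x} {0ℚ - y} x∈ (-∈ℤₚ {0ℚ} {y} p∤1 y∈))

  *∈ : ∀ {x y} → x ∈ ℤₚ → y ∈ ℤₚ → x * y ∈ ℤₚ
  *∈ {x} {y} x∈ y∈ = ∈ℤₚ (x * y) (↥x ℤ.* ↥y) (dx ℕ.* dy) eq (p∤* x∈ y∈)
    where
    open ℚ using (denominatorℕ; numerator)
    dx = denominatorℕ x
    dy = denominatorℕ y
    ↥x = numerator x
    ↥y = numerator y
    eq : x * y * ι (dx ℕ.* dy) ≡ fromℤ (↥x ℤ.* ↥y)
    eq = begin
      x * y * ι (dx ℕ.* dy)          ≡⟨ cong (x * y *_) (ι-* dx dy) ⟩
      x * y * (ι dx * ι dy)          ≡⟨ solve 4 (λ x y c d → x :* y :* (c :* d) := x :* c :* (y :* d)) refl x y (ι dx) (ι dy) ⟩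
      x * ι dx * (y * ι dy)          ≡⟨ cong₂ _*_ (*-↧ x) (*-↧ y) ⟩
      fromℤ ↥x * fromℤ ↥y            ≡⟨ fromℤ-* ↥x ↥y ⟨
      fromℤ (↥x ℤ.* ↥y)              ∎

  ^∈ : ∀ {x} n → x ∈ ℤₚ → x ^ℚ n ∈ ℤₚ
  ^∈     zero    x∈ = p∤1
  ^∈ {x} (suc n) x∈ = *∈ {x} {x ^ℚ n} x∈ (^∈ {x} n x∈)

  ∑∈ : ∀ n f → (∀ k → k ℕ.< n → f k ∈ ℤₚ) → ∑ n f ∈ ℤₚ
  ∑∈ zero    f f∈ = p∤1
  ∑∈ (suc n) f f∈ = subst (_∈ ℤₚ) (sym (∑-suc n f))
    (+∈ {∑ n f} {f n} (∑∈ n f (λ k k<n → f∈ k (ℕ.m<n⇒m<1+n k<n))) (f∈ n ℕ.≤-refl))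

  1/n∈ : ∀ n .{{_ : ℕ.NonZero n}} → ¬ p ∣ n → + 1 / n ∈ ℤₚ
  1/n∈ n p∤n = ∈ℤₚ (+ 1 / n) (+ 1) n (/-*-cancel n) p∤n

  p∤ : ∀ n .{{_ : ℕ.NonZero n}} → n ℕ.< p → ¬ p ∣ n
  p∤ n n<p p∣n = ℕ.<⇒≱ n<p (∣⇒≤ p∣n)

  p∤! : ∀ k → k ℕ.< p → ¬ p ∣ k !
  p∤! zero    _   = p∤1
  p∤! (suc k) k<p = p∤* (p∤ (suc k) k<p) (p∤! k (ℕ.<⇒≤ k<p))

  p∤^ : ∀ {m} k → ¬ p ∣ m → ¬ p ∣ m ℕ.^ k
  p∤^ zero    _   = p∤1
  p∤^ (suc k) p∤m = p∤* p∤m (p∤^ k p∤m)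

  falling∈ : ∀ {x} n → x ∈ ℤₚ → falling x n ∈ ℤₚ
  falling∈     zero    x∈ = p∤1
  falling∈ {x} (suc n) x∈ = *∈ {falling x n} {x - ι n} (falling∈ {x} n x∈) (-∈ℤₚ {x} {ι n} x∈ p∤1)

  1/!∈ : ∀ {k} → k ℕ.< p → 1/[ k ]! ∈ ℤₚ
  1/!∈ {k} k<p = 1/n∈ (k !) (p∤! k k<p)
    where instance _ = k ℕ.!≢0

  binom∈ : ∀ {x k} → k ℕ.< p → x ∈ ℤₚ → binom x k ∈ ℤₚ
  binom∈ {x} {k} k<p x∈ = *∈ {falling x k} {1/[ k ]!} (falling∈ {x} k x∈) (1/!∈ k<p)

  summand∈ : ∀ {a k} → 4 ℕ.< p → k ℕ.< p → a ∈ ℤₚ → summand a k ∈ ℤₚ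
  summand∈ {a} {k} 4<p k<p a∈ =
    *∈ {binom a k * binom (- 1ℚ - a) k * ι ((2 ℕ.* k) C k)} {1/4^[ k ]}
      (*∈ {binom a k * binom (- 1ℚ - a) k} {ι ((2 ℕ.* k) C k)}
        (*∈ {binom a k} {binom (- 1ℚ - a) k} (binom∈ k<p a∈) (binom∈ k<p (-∈ℤₚ { - 1ℚ} {a} p∤1 a∈)))
        p∤1)
      (1/n∈ (4 ℕ.^ k) (p∤^ k (p∤ 4 4<p)))
    where instance _ = ℕ.m^n≢0 4 k

  -- Congruence modulo p.

  infix 4 _≈_

  -- Keeps the cofactor instead of dividing by p, so that `equation` can be substituted directly.
  -- Membership in ℤₚ is carried across it by `∈-of`.
  record _≈_ (x y : ℚ) : Set where
    constructor near
    field
      cofactor  : ℚ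
      cofactor∈ : cofactor ∈ ℤₚ
      equation  : x ≡ y + ι p * cofactor

  ≈-refl : ∀ {x} → x ≈ x
  ≈-refl {x} = near 0ℚ p∤1 (solve 2 (λ x p → x := x :+ p :* con 0ℚ) refl x (ι p))

  -- Rests on xu - yv = (x - y) u + y (u - v), which is why membership is asked of `y` and `u`.
  *-cong-≈ : ∀ {x y u v} → y ∈ ℤₚ → u ∈ ℤₚ → x ≈ y → u ≈ v → x * u ≈ y * v
  *-cong-≈ {_} {y} {u} {v} y∈ u∈ (near z z∈ refl) (near w w∈ u≡) = near
    (z * u + y * w) (+∈ {z * u} {y * w} (*∈ {z} {u} z∈ u∈) (*∈ {y} {w} y∈ w∈)) (begin
      (y + ι p * z) * u                   ≡⟨ solve 4 (λ y p z u → (y :+ p :* z) :* u := y :* u :+ p :* (z :* u)) refl y (ι p) z u ⟩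
      y * u + ι p * (z * u)               ≡⟨ cong (λ t → y * t + ι p * (z * u)) u≡ ⟩
      y * (v + ι p * w) + ι p * (z * u)   ≡⟨ solve 5 (λ y v p w t → y :* (v :+ p :* w) :+ p :* t := y :* v :+ p :* (t :+ y :* w)) refl y v (ι p) w (z * u) ⟩
      y * v + ι p * (z * u + y * w)       ∎)

  -ˡ-cong-≈ : ∀ {x y} c → x ≈ y → x - c ≈ y - c
  -ˡ-cong-≈ {_} {y} c (near z z∈ refl) = near z z∈
    (solve 4 (λ y p z c → y :+ p :* z :- c := y :- c :+ p :* z) refl y (ι p) z c)

  falling-cong-≈ : ∀ {x y} n → x ∈ ℤₚ → y ∈ ℤₚ → x ≈ y → falling x n ≈ falling y n
  falling-cong-≈         zero    x∈ y∈ x≈y = ≈-refl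
  falling-cong-≈ {x} {y} (suc n) x∈ y∈ x≈y =
    *-cong-≈ {falling x n} {falling y n} {x - ι n} {y - ι n}
      (falling∈ {y} n y∈) (-∈ℤₚ {x} {ι n} x∈ p∤1) (falling-cong-≈ n x∈ y∈ x≈y) (-ˡ-cong-≈ (ι n) x≈y)

  ∈-of : ∀ {x y} → y ∈ ℤₚ → x ≈ y → x ∈ ℤₚ
  ∈-of {_} {y} y∈ (near z z∈ refl) = +∈ {y} {ι p * z} y∈ (*∈ {ι p} {z} p∤1 z∈)

  -- Residues modulo p of binomial coefficients with lower index p.

  -- Among the p consecutive factors x, x - 1, …, x - (p - 1) only x - r is divisible by p;
  -- modulo p the others run through the nonzero residues.
  falling-p : ∀ r n z → p ≡ suc (r ℕ.+ n) → z ∈ ℤₚ →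
    let x = ι r + ι p * z in
    ∃ λ M → M ≈ ι ((r ℕ.+ n) !) × falling x p ≡ ι p * z * M
  falling-p r n z p≡ z∈ = falling x r * falling y n , M≈ , eq
    where
    x = ι r + ι p * z
    y = ι p * z - 1ℚ
    x∈ : x ∈ ℤₚ
    x∈ = +∈ {ι r} {ι p * z} p∤1 (*∈ {ι p} {z} p∤1 z∈)
    y∈ : y ∈ ℤₚ
    y∈ = -∈ℤₚ {ι p * z} {1ℚ} (*∈ {ι p} {z} p∤1 z∈) p∤1
    -- The n factors after the divisible one start at pz - 1 ≡ p - 1 = n + r, so modulo p they are n
    -- + r, ..., r + 1; the r factors before it give r!.
    y≈ : y ≈ ι (n ℕ.+ r)
    y≈ = near (z - 1ℚ) (-∈ℤₚ {z} {1ℚ} z∈ p∤1) (begin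
      ι p * z - 1ℚ
        ≡⟨ solve 2 (λ p z → p :* z :- con 1ℚ := (p :- con 1ℚ) :+ p :* (z :- con 1ℚ)) refl (ι p) z ⟩
      ι p - 1ℚ + ι p * (z - 1ℚ)
        ≡⟨ cong (λ u → u - 1ℚ + ι p * (z - 1ℚ)) (trans (cong ι p≡) (ι-suc (r ℕ.+ n))) ⟩
      1ℚ + ι (r ℕ.+ n) - 1ℚ + ι p * (z - 1ℚ)
        ≡⟨ solve 2 (λ s t → con 1ℚ :+ s :- con 1ℚ :+ t := s :+ t) refl (ι (r ℕ.+ n)) (ι p * (z - 1ℚ)) ⟩
      ι (r ℕ.+ n) + ι p * (z - 1ℚ)
        ≡⟨ cong (λ m → ι m + ι p * (z - 1ℚ)) (ℕ.+-comm r n) ⟩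
      ι (n ℕ.+ r) + ι p * (z - 1ℚ) ∎)
    M≈ : falling x r * falling y n ≈ ι ((r ℕ.+ n) !)
    M≈ = subst (falling x r * falling y n ≈_)
      (begin
        falling (ι r) r * falling (ι (n ℕ.+ r)) n   ≡⟨ cong (_* falling (ι (n ℕ.+ r)) n) (falling-n-n r) ⟩
        ι (r !) * falling (ι (n ℕ.+ r)) n           ≡⟨ *-comm (ι (r !)) (falling (ι (n ℕ.+ r)) n) ⟩
        falling (ι (n ℕ.+ r)) n * ι (r !)           ≡⟨ falling-! n r ⟩
        ι ((n ℕ.+ r) !)                             ≡⟨ cong (λ m → ι (m !)) (ℕ.+-comm n r) ⟩
        ι ((r ℕ.+ n) !)                             ∎)
      (*-cong-≈ {falling x r} {falling (ι r) r} {falling y n} {falling (ι (n ℕ.+ r)) n}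
        (falling∈ {ι r} r p∤1) (falling∈ {y} n y∈)
        (falling-cong-≈ {x} {ι r} r x∈ p∤1 (near z z∈ refl))
        (falling-cong-≈ {y} {ι (n ℕ.+ r)} n y∈ p∤1 y≈))
    eq : falling x p ≡ ι p * z * (falling x r * falling y n)
    eq = begin
      falling x p
        ≡⟨ cong (falling x) (trans p≡ (sym (ℕ.+-suc r n))) ⟩
      falling x (r ℕ.+ suc n)
        ≡⟨ falling-+ x r (suc n) ⟩
      falling x r * falling (x - ι r) (suc n)
        ≡⟨ cong (λ u → falling x r * falling u (suc n))
             (solve 2 (λ r t → r :+ t :- r := t) refl (ι r) (ι p * z)) ⟩
      falling x r * falling (ι p * z) (suc n)
        ≡⟨ cong (falling x r *_) (falling-head (ι p * z) n) ⟩
      falling x r * (ι p * z * falling y n)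
        ≡⟨ solve 3 (λ f t g → f :* (t :* g) := t :* (f :* g)) refl (falling x r) (ι p * z) (falling y n) ⟩
      ι p * z * (falling x r * falling y n) ∎

  -- By `falling-p` the numerator is p z M with M ≡ (p - 1)! modulo p. The p cancels against p! = p
  -- (p - 1)!, and (p - 1)! is a unit in ℤₚ.
  binom-p : ∀ r n z → p ≡ suc (r ℕ.+ n) → z ∈ ℤₚ → binom (ι r + ι p * z) p ≈ z
  binom-p r n z p≡ z∈ = from (falling-p r n z p≡ z∈)
    where
    m = r ℕ.+ n
    x = ι r + ι p * z
    F = 1/[ m ]!
    m<p : m ℕ.< p
    m<p = ℕ.≤-reflexive (sym p≡)
    F-suc : 1/[ p ]! * ι p ≡ F
    F-suc = subst (λ q → 1/[ q ]! * ι q ≡ F) (sym p≡) (1/!-suc m)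
    from : (∃ λ M → M ≈ ι (m !) × falling x p ≡ ι p * z * M) → binom x p ≈ z
    from (M , near t t∈ M≡ , eq) = near
      (z * t * F) (*∈ {z * t} {F} (*∈ {z} {t} z∈ t∈) (1/!∈ m<p)) (begin
      falling x p * 1/[ p ]!
        ≡⟨ cong (_* 1/[ p ]!) eq ⟩
      ι p * z * M * 1/[ p ]!
        ≡⟨ solve 4 (λ p z M F → p :* z :* M :* F := z :* M :* (F :* p)) refl (ι p) z M 1/[ p ]! ⟩
      z * M * (1/[ p ]! * ι p)
        ≡⟨ cong₂ (λ u v → z * u * v) M≡ F-suc ⟩
      z * (ι (m !) + ι p * t) * F
        ≡⟨ solve 5 (λ z m p t F → z :* (m :+ p :* t) :* F := z :* (F :* m) :+ p :* (z :* t :* F)) refl z (ι (m !)) (ι p) t F ⟩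
      z * (F * ι (m !)) + ι p * (z * t * F)
        ≡⟨ cong (λ u → z * u + ι p * (z * t * F)) (1/!-cancel m) ⟩
      z * 1ℚ + ι p * (z * t * F)
        ≡⟨ cong (_+ ι p * (z * t * F)) (*-identityʳ z) ⟩
      z + ι p * (z * t * F) ∎)

  p-odd : 2 ℕ.< p → ∃ λ h → p ≡ suc (h ℕ.+ h)
  p-odd 2<p with even-or-odd p
  ... | h , inj₂ p≡ = h , p≡
  ... | h , inj₁ p≡ with prime⇒irreducible pr
        (divides h (trans p≡ (trans (cong (h ℕ.+_) (sym (ℕ.+-identityʳ h))) (ℕ.*-comm 2 h))))
  ...   | inj₂ 2≡p = contradiction 2≡p (ℕ.<⇒≢ 2<p)

  ½∈ : 2 ℕ.< p → ½ ∈ ℤₚ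
  ½∈ = p∤ 2

  -- With p = 2h + 1 one has -½ = h + p (-½), so C(-½, p) ≡ -½ by `binom-p`; the sign (-1)ᵖ is -1.
  central-p : 2 ℕ.< p → central p ≈ ½
  central-p 2<p with p-odd 2<p
  ... | h , p≡ = subst₂ _≈_ (sym eq) refl
    (*-cong-≈ { - 1ℚ} { - 1ℚ} {binom x p} { -½} p∤1
      (∈-of (½∈ 2<p) b≈) ≈-refl b≈)
    where
    x = ι h + ι p * -½
    b≈ : binom x p ≈ -½
    b≈ = binom-p h h -½ p≡ (½∈ 2<p)
    x≡ : -½ ≡ x
    x≡ = sym (begin
      ι h + ι p * -½                    ≡⟨ cong (λ u → ι h + u * -½) (trans (cong ι p≡) (trans (ι-suc (h ℕ.+ h)) (cong (λ u → 1ℚ + u) (ι-+ h h)))) ⟩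
      ι h + (1ℚ + (ι h + ι h)) * -½     ≡⟨ solve 1 (λ h → h :+ (con 1ℚ :+ (h :+ h)) :* con -½ := con -½) refl (ι h) ⟩
      -½                                ∎)
    sign : (- 1ℚ) ^ℚ p ≡ - 1ℚ
    sign = begin
      (- 1ℚ) ^ℚ p                    ≡⟨ cong ((- 1ℚ) ^ℚ_) p≡ ⟩
      - 1ℚ * (- 1ℚ) ^ℚ (h ℕ.+ h)     ≡⟨ cong (- 1ℚ *_) (-1^even h) ⟩
      - 1ℚ * 1ℚ                      ≡⟨⟩
      - 1ℚ                           ∎
    eq : central p ≡ - 1ℚ * binom x p
    eq = trans (central≡binom p) (cong₂ (λ u v → u * binom v p) sign x≡)

  -- The shape of `p≡` says r + 1 < p, so a + 1 = (r + 1) + p z has residue r + 1. Since p = r + n +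
  -- 2, also -1 - a = (n + 1) + p (-1 - z), and `binom-p` applies to both.
  weight-p : ∀ a r n z → 2 ℕ.< p → z ∈ ℤₚ → p ≡ suc (suc r ℕ.+ n) → a ≡ ι r + ι p * z →
             weight a p ≈ z * (- 1ℚ - z) * ½
  weight-p a r n z 2<p z∈ p≡ a≡ =
    *-cong-≈ {binom (a + 1ℚ) p * binom (- 1ℚ - a) p} {z * z′} {central p} {½} (*∈ {z} {z′} z∈ z′∈) (∈-of (½∈ 2<p) (central-p 2<p))
      (*-cong-≈ {binom (a + 1ℚ) p} {z} {binom (- 1ℚ - a) p} {z′} z∈ (∈-of z′∈ b′≈) b≈ b′≈) (central-p 2<p)
    where
    z′ = - 1ℚ - z
    z′∈ : z′ ∈ ℤₚ
    z′∈ = -∈ℤₚ { - 1ℚ} {z} p∤1 z∈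
    b≈ : binom (a + 1ℚ) p ≈ z
    b≈ = subst (λ x → binom x p ≈ z) (sym (begin
      a + 1ℚ                  ≡⟨ cong (_+ 1ℚ) a≡ ⟩
      ι r + ι p * z + 1ℚ      ≡⟨ solve 2 (λ r t → r :+ t :+ con 1ℚ := (con 1ℚ :+ r) :+ t) refl (ι r) (ι p * z) ⟩
      1ℚ + ι r + ι p * z      ≡⟨ cong (_+ ι p * z) (ι-suc r) ⟨
      ι (suc r) + ι p * z     ∎)) (binom-p (suc r) n z p≡ z∈)
    p≡′ : ι p ≡ 1ℚ + (1ℚ + (ι r + ι n))
    p≡′ = trans (cong ι p≡) (trans (ι-suc (suc r ℕ.+ n)) (cong (λ u → 1ℚ + u)
      (trans (ι-suc (r ℕ.+ n)) (cong (λ u → 1ℚ + u) (ι-+ r n)))))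
    b′≈ : binom (- 1ℚ - a) p ≈ z′
    b′≈ = subst (λ x → binom x p ≈ z′) (sym (begin
      - 1ℚ - a
        ≡⟨ cong (λ u → - 1ℚ - u) a≡ ⟩
      - 1ℚ - (ι r + ι p * z)
        ≡⟨ solve 4 (λ r p n z → con (- 1ℚ) :- (r :+ p :* z)
             := con 1ℚ :+ n :- (con 1ℚ :+ (con 1ℚ :+ (r :+ n))) :- p :* z) refl (ι r) (ι p) (ι n) z ⟩
      1ℚ + ι n - (1ℚ + (1ℚ + (ι r + ι n))) - ι p * z
        ≡⟨ cong₂ (λ u v → u - v - ι p * z) (ι-suc n) p≡′ ⟨
      ι (suc n) - ι p - ι p * z
        ≡⟨ solve 3 (λ n p z → n :- p :- p :* z := n :+ p :* (con (- 1ℚ) :- z)) refl (ι (suc n)) (ι p) z ⟩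
      ι (suc n) + ι p * z′ ∎))
      (binom-p (suc n) r z′ (trans p≡ (cong (λ m → suc (suc m)) (ℕ.+-comm r n))) z′∈)

  -- Units of ℤₚ and congruences modulo powers of p.

  -- Clearing the denominator d of the cofactor makes p divide n d, and p does not divide d.
  p∣-of-≈0 : ∀ {n} → ι n ≈ 0ℚ → p ∣ n
  p∣-of-≈0 {n} (near z z∈ eq) =
    [ (λ p∣n → p∣n) , (λ p∣d → contradiction p∣d z∈) ]′
      (euclidsLemma n (ℚ.denominatorℕ z) pr
        (subst (p ∣_) (ℤ.abs-* (+ n) (ℚ.denominator z))
          (ℤ.∣⇒∣ᵤ (ℤ.divides (ℚ.numerator z) (sym (clear z (+ n) p
            (trans (*-comm z (ι p)) (sym (trans eq (+-identityˡ (ι p * z)))))))))))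

  ≈0-of-p∣ : ∀ {x} → x ∈ ℤₚ → p ∣ ℤ.∣ ℚ.numerator x ∣ → x ≈ 0ℚ
  ≈0-of-p∣ {x} x∈ p∣ with ℤ.∣ᵤ⇒∣ {+ p} {ℚ.numerator x} p∣
  ... | ℤ.divides t eq = near (x * (+ 1 / p)) (∈ℤₚ (x * (+ 1 / p)) t d eq′ x∈) (sym (begin
      0ℚ + ι p * (x * (+ 1 / p))    ≡⟨ solve 3 (λ p x r → con 0ℚ :+ p :* (x :* r) := x :* (r :* p)) refl (ι p) x (+ 1 / p) ⟩
      x * ((+ 1 / p) * ι p)         ≡⟨ cong (x *_) (/-*-cancel p) ⟩
      x * 1ℚ                        ≡⟨ *-identityʳ x ⟩
      x                             ∎))
    where
    d = ℚ.denominatorℕ x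
    eq′ : x * (+ 1 / p) * ι d ≡ fromℤ t
    eq′ = begin
      x * (+ 1 / p) * ι d           ≡⟨ solve 3 (λ x r d → x :* r :* d := x :* d :* r) refl x (+ 1 / p) (ι d) ⟩
      x * ι d * (+ 1 / p)           ≡⟨ cong (_* (+ 1 / p)) (*-↧ x) ⟩
      fromℤ (ℚ.numerator x) * (+ 1 / p)   ≡⟨ cong (λ i → fromℤ i * (+ 1 / p)) eq ⟩
      fromℤ (t ℤ.* + p) * (+ 1 / p)   ≡⟨ cong (_* (+ 1 / p)) (fromℤ-* t (+ p)) ⟩
      fromℤ t * ι p * (+ 1 / p)     ≡⟨ solve 3 (λ t p r → t :* p :* r := t :* (r :* p)) refl (fromℤ t) (ι p) (+ 1 / p) ⟩
      fromℤ t * ((+ 1 / p) * ι p)   ≡⟨ cong (fromℤ t *_) (/-*-cancel p) ⟩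
      fromℤ t * 1ℚ                  ≡⟨ *-identityʳ (fromℤ t) ⟩
      fromℤ t                       ∎

  -- Clearing the denominator of x in y x = 1 gives y · numerator = denominator, and p does not
  -- divide the numerator because x is nonzero modulo p.
  inverse∈ : ∀ {x y} → x ∈ ℤₚ → ¬ x ≈ 0ℚ → y * x ≡ 1ℚ → y ∈ ℤₚ
  inverse∈ {x} {y} x∈ x≉0 yx≡1 = numerator-unit (ℚ.numerator x) (λ p∣ → x≉0 (≈0-of-p∣ x∈ p∣)) (begin
    y * fromℤ (ℚ.numerator x)   ≡⟨ cong (y *_) (*-↧ x) ⟨
    y * (x * ι d)               ≡⟨ *-assoc y x (ι d) ⟨
    y * x * ι d                 ≡⟨ cong (_* ι d) yx≡1 ⟩
    1ℚ * ι d                    ≡⟨ *-identityˡ (ι d) ⟩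
    ι d                         ∎)
    where
    d = ℚ.denominatorℕ x
    numerator-unit : ∀ i → ¬ p ∣ ℤ.∣ i ∣ → y * fromℤ i ≡ ι d → y ∈ ℤₚ
    numerator-unit (+ n)    p∤n eq = ∈ℤₚ y (+ d) n eq p∤n
    -- `∈ℤₚ` takes a natural number as denominator, so the sign moves to d.
    numerator-unit -[1+ n ] p∤n eq = ∈ℤₚ y (ℤ.- (+ d)) (suc n) (begin
      y * ι (suc n)             ≡⟨ solve 2 (λ y m → y :* m := :- (y :* :- m)) refl y (ι (suc n)) ⟩
      - (y * - ι (suc n))       ≡⟨ cong -_ eq ⟩
      - ι d                     ∎) p∤n

  1/p^-cancel : ∀ n → (1/p^ n) * ι p ^ℚ n ≡ 1ℚ
  1/p^-cancel n = trans (cong ((1/p^ n) *_) (sym (ι-^ p n))) (/-*-cancel (p ℕ.^ n))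
    where instance _ = ℕ.m^n≢0 p n

  -- As y = x - pⁿ z, membership of `y` is derived; the long right side of the theorem need not be
  -- inspected term by term.
  mod-p^-intro : ∀ {x y} n z → x ∈ ℤₚ → z ∈ ℤₚ → x - y ≡ ι p ^ℚ n * z → x ≡ y [mod-p^ n ]
  mod-p^-intro {x} {y} n z x∈ z∈ eq = congruent x∈
    (subst (_∈ ℤₚ) (begin
      x - ι p ^ℚ n * z   ≡⟨ cong (λ u → x - u) eq ⟨
      x - (x - y)        ≡⟨ solve 2 (λ x y → x :- (x :- y) := y) refl x y ⟩
      y                  ∎) (-∈ℤₚ {x} {ι p ^ℚ n * z} x∈ (*∈ {ι p ^ℚ n} {z} (^∈ {ι p} n p∤1) z∈)))
    (subst (_∈ ℤₚ) (sym (begin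
      (x - y) * (1/p^ n)           ≡⟨ cong (_* (1/p^ n)) eq ⟩
      ι p ^ℚ n * z * (1/p^ n)      ≡⟨ solve 3 (λ P z r → P :* z :* r := z :* (r :* P)) refl (ι p ^ℚ n) z (1/p^ n) ⟩
      z * ((1/p^ n) * ι p ^ℚ n)    ≡⟨ cong (z *_) (1/p^-cancel n) ⟩
      z * 1ℚ                       ≡⟨ *-identityʳ z ⟩
      z                            ∎)) z∈)

  -- The residue of a, and 15 (a + 1) as a unit.

  residueQuotient∈ : ∀ {a r} → a ≡ ι r [mod-p^ 1 ] → (a - ι r) * (+ 1 / p) ∈ ℤₚ
  residueQuotient∈ {a} {r} a≡r = subst (λ u → (a - ι r) * u ∈ ℤₚ)
    (1/-unique p 1/p^1*p≡1) (_≡_[mod-p^_].quotient a≡r)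

  residueQuotient-spec : ∀ a r → a ≡ ι r + ι p * ((a - ι r) * (+ 1 / p))
  residueQuotient-spec a r = sym (begin
    ι r + ι p * ((a - ι r) * (+ 1 / p))   ≡⟨ solve 4 (λ a r p q → r :+ p :* ((a :- r) :* q) := r :+ (a :- r) :* (q :* p)) refl a (ι r) (ι p) (+ 1 / p) ⟩
    ι r + (a - ι r) * ((+ 1 / p) * ι p)   ≡⟨ cong (λ u → ι r + (a - ι r) * u) (/-*-cancel p) ⟩
    ι r + (a - ι r) * 1ℚ                  ≡⟨ solve 2 (λ a r → r :+ (a :- r) :* con 1ℚ := a) refl a (ι r) ⟩
    a                                     ∎)

  -- If r + 1 = p, then a + 1 = p + p z = p (1 + z), contrary to the assumption on a.
  residue≢p-1 : ∀ {a r z} → a ∈ ℤₚ → z ∈ ℤₚ → a ≡ ι r + ι p * z →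
                ¬ (a ≡ - 1ℚ [mod-p^ 1 ]) → suc r ≢ p
  residue≢p-1 {a} {r} {z} a∈ z∈ a≡ a≢-1 p≡ = a≢-1
    (mod-p^-intro 1 (1ℚ + z) a∈ (+∈ {1ℚ} {z} p∤1 z∈) (begin
      a - - 1ℚ                     ≡⟨ cong (_- - 1ℚ) a≡ ⟩
      ι r + ι p * z - - 1ℚ         ≡⟨ solve 2 (λ r t → r :+ t :- con (- 1ℚ) := con 1ℚ :+ r :+ t) refl (ι r) (ι p * z) ⟩
      1ℚ + ι r + ι p * z           ≡⟨ cong (_+ ι p * z) (trans (sym (ι-suc r)) (cong ι p≡)) ⟩
      ι p + ι p * z                ≡⟨ solve 2 (λ p z → p :+ p :* z := p :* con 1ℚ :* (con 1ℚ :+ z)) refl (ι p) z ⟩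
      ι p ^ℚ 1 * (1ℚ + z)          ∎))

  p∤15 : 5 ℕ.< p → ¬ p ∣ 15
  p∤15 5<p = p∤* {3} {5} (p∤ 3 (ℕ.≤-trans (ℕ.s≤s (ℕ.s≤s (ℕ.s≤s (ℕ.s≤s ℕ.z≤n)))) 5<p)) (p∤ 5 5<p)

  -- Modulo p this is 15 (r + 1), where p > 5 excludes the primes 3 and 5 and 0 < r + 1 < p excludes
  -- the other factor.
  15[a+1]≉0 : ∀ {a r z} → 5 ℕ.< p → suc r ℕ.< p → z ∈ ℤₚ → a ≡ ι r + ι p * z →
              ¬ ι 15 * (a + 1ℚ) ≈ 0ℚ
  15[a+1]≉0 {a} {r} {z} 5<p r+1<p z∈ a≡ (near t t∈ eq) =
    p∤* {15} {suc r} (p∤15 5<p) (p∤ (suc r) r+1<p) (p∣-of-≈0 (near (t - ι 15 * z)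
      (-∈ℤₚ {t} {ι 15 * z} t∈ (*∈ {ι 15} {z} p∤1 z∈)) (begin
        ι (15 ℕ.* suc r)
          ≡⟨ ι-* 15 (suc r) ⟩
        ι 15 * ι (suc r)
          ≡⟨ cong (ι 15 *_) (ι-suc r) ⟩
        ι 15 * (1ℚ + ι r)
          ≡⟨ solve 3 (λ r p z → con (ι 15) :* (con 1ℚ :+ r)
               := con (ι 15) :* (r :+ p :* z :+ con 1ℚ) :- p :* (con (ι 15) :* z)) refl (ι r) (ι p) z ⟩
        ι 15 * (ι r + ι p * z + 1ℚ) - ι p * (ι 15 * z)
          ≡⟨ cong (λ u → ι 15 * (u + 1ℚ) - ι p * (ι 15 * z)) a≡ ⟨
        ι 15 * (a + 1ℚ) - ι p * (ι 15 * z)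
          ≡⟨ cong (_- ι p * (ι 15 * z)) eq ⟩
        0ℚ + ι p * t - ι p * (ι 15 * z)
          ≡⟨ solve 3 (λ p t s → con 0ℚ :+ p :* t :- p :* s := con 0ℚ :+ p :* (t :- s)) refl (ι p) t (ι 15 * z) ⟩
        0ℚ + ι p * (t - ι 15 * z) ∎)))

  -- The boundary term at n = p and the final congruence.

  γ∈ : ∀ {a} → a ∈ ℤₚ → γ a ∈ ℤₚ
  γ∈ {a} a∈ =
    +∈ {ι 4 * a ^ℚ 4 + ι 6 * a ^ℚ 3 - a ^ℚ 2 + a} {ι 5}
      (+∈ {ι 4 * a ^ℚ 4 + ι 6 * a ^ℚ 3 - a ^ℚ 2} {a}
        (-∈ℤₚ {ι 4 * a ^ℚ 4 + ι 6 * a ^ℚ 3} {a ^ℚ 2}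
          (+∈ {ι 4 * a ^ℚ 4} {ι 6 * a ^ℚ 3}
            (*∈ {ι 4} {a ^ℚ 4} p∤1 (^∈ {a} 4 a∈))
            (*∈ {ι 6} {a ^ℚ 3} p∤1 (^∈ {a} 3 a∈)))
          (^∈ {a} 2 a∈))
        a∈)
      p∤1

  -- At k = p the part of `certificate` after the constant term is visibly p times a cofactor, hence
  -- the `refl`.
  certificate-p : ∀ {a} → a ∈ ℤₚ → certificate a (ι p) ≈ - ι 2 * γ a
  certificate-p {a} a∈ = near (ι 14 + ι 2 * a - ι 4 * a ^ℚ 2 - ι 6 * ι p)
    (-∈ℤₚ {ι 14 + ι 2 * a - ι 4 * a ^ℚ 2} {ι 6 * ι p}
      (-∈ℤₚ {ι 14 + ι 2 * a} {ι 4 * a ^ℚ 2}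
        (+∈ {ι 14} {ι 2 * a} p∤1 (*∈ {ι 2} {a} p∤1 a∈))
        (*∈ {ι 4} {a ^ℚ 2} p∤1 (^∈ {a} 2 a∈)))
      (*∈ {ι 6} {ι p} p∤1 p∤1))
    refl

  moment₃ : ℚ → ℚ
  moment₃ a = ∑ p (λ k → ι k ^ℚ 3 * summand a k)

  moment₃∈ : ∀ {a} → 4 ℕ.< p → a ∈ ℤₚ → moment₃ a ∈ ℤₚ
  moment₃∈ {a} 4<p a∈ = ∑∈ p (λ k → ι k ^ℚ 3 * summand a k)
    (λ k k<p → *∈ {ι k ^ℚ 3} {summand a k} (^∈ {ι k} 3 p∤1) (summand∈ {a} {k} 4<p k<p a∈))

  -- The limits multiply to -2 γ · z (-1 - z) / 2 = γ z (z + 1).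
  boundary-p : ∀ {a r n z} → 2 ℕ.< p → a ∈ ℤₚ → z ∈ ℤₚ → p ≡ suc (suc r ℕ.+ n) → a ≡ ι r + ι p * z →
               certificate a (ι p) * weight a p ≈ γ a * z * (z + 1ℚ)
  boundary-p {a} {r} {n} {z} 2<p a∈ z∈ p≡ a≡ = subst (certificate a (ι p) * weight a p ≈_)
    (solve 2 (λ g z → con (- ι 2) :* g :* (z :* (con (- 1ℚ) :- z) :* con ½) := g :* z :* (z :+ con 1ℚ)) refl (γ a) z)
    (*-cong-≈ {certificate a (ι p)} { - ι 2 * γ a} {weight a p} {z * (- 1ℚ - z) * ½}
      (*∈ { - ι 2} {γ a} p∤1 (γ∈ {a} a∈)) (∈-of limit∈ weight≈) (certificate-p {a} a∈) weight≈)
    where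
    weight≈ : weight a p ≈ z * (- 1ℚ - z) * ½
    weight≈ = weight-p a r n z 2<p z∈ p≡ a≡
    limit∈ : z * (- 1ℚ - z) * ½ ∈ ℤₚ
    limit∈ = *∈ {z * (- 1ℚ - z)} {½} (*∈ {z} { - 1ℚ - z} z∈ (-∈ℤₚ { - 1ℚ} {z} p∤1 z∈)) (½∈ 2<p)

  -- The boundary term of `telescope` at p carries the factor p³, so knowing the rest modulo p
  -- suffices for modulus p⁴. `I` abstracts the inverse of 15 (a + 1) and is in ℤₚ because that
  -- number is a unit.
  moment₃-congruence : ∀ {a r z I} → 5 ℕ.< p → a ∈ ℤₚ → ¬ (a ≡ - 1ℚ [mod-p^ 1 ]) → r ℕ.< p → z ∈ ℤₚ →
    a ≡ ι r + ι p * z → I * (ι 15 * (a + 1ℚ)) ≡ 1ℚ →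
    moment₃ a ≡ α a ÷ ι 15 * S p a - β a ÷ ι 15 * S p (a + 1ℚ) + γ a * I * z * (z + 1ℚ) * ι p ^ℚ 3 [mod-p^ 4 ]
  moment₃-congruence {a} {r} {z} {I} 5<p a∈ a≢-1 r<p z∈ a≡ I-inv =
    conclude (boundary-p {a} {r} {proj₁ gap} {z} 2<p a∈ z∈ (sym (proj₂ gap)) a≡)
    where
    2<p : 2 ℕ.< p
    2<p = ℕ.≤-trans (ℕ.s≤s (ℕ.s≤s (ℕ.s≤s ℕ.z≤n))) 5<p
    r+1<p : suc r ℕ.< p
    r+1<p = ℕ.≤∧≢⇒< r<p (residue≢p-1 {a} {r} {z} a∈ z∈ a≡ a≢-1)
    gap : ∃ λ n → suc (suc r) ℕ.+ n ≡ p
    gap = ℕ.m≤n⇒∃[o]m+o≡n r+1<p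
    I∈ : I ∈ ℤₚ
    I∈ = inverse∈ {ι 15 * (a + 1ℚ)} {I}
      (*∈ {ι 15} {a + 1ℚ} p∤1 (+∈ {a} {1ℚ} a∈ p∤1))
      (15[a+1]≉0 {a} {r} {z} 5<p r+1<p z∈ a≡) I-inv
    b = a + 1ℚ
    m = moment₃ a
    A = α a
    B = β a
    s = S p a
    s′ = S p b
    e = γ a * z * (z + 1ℚ)
    Qw = certificate a (ι p) * weight a p
    difference : ∀ t → Qw ≡ e + ι p * t →
      m - (A ÷ ι 15 * s - B ÷ ι 15 * s′ + γ a * I * z * (z + 1ℚ) * ι p ^ℚ 3) ≡ ι p ^ℚ 4 * (I * t)
    difference t Qw≡ = begin
      m - (A ÷ ι 15 * s - B ÷ ι 15 * s′ + γ a * I * z * (z + 1ℚ) * ι p ^ℚ 3)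
        ≡⟨ solve 9 (λ m A B s s′ g I z P →
             m :- (A :* con (+ 1 / 15) :* s :- B :* con (+ 1 / 15) :* s′ :+ g :* I :* z :* (z :+ con 1ℚ) :* P)
               := con (+ 1 / 15) :* (con 1ℚ :* (con (ι 15) :* m :- A :* s :+ B :* s′)) :- I :* (P :* (g :* z :* (z :+ con 1ℚ))))
             refl m A B s s′ (γ a) I z (ι p ^ℚ 3) ⟩
      -- The factor `1ℚ` is a placeholder for I · 15 (a + 1), which supplies the a + 1 on the left
      -- of `telescope`.
      (+ 1 / 15) * (1ℚ * (ι 15 * m - A * s + B * s′)) - I * (ι p ^ℚ 3 * e)
        ≡⟨ cong (λ u → (+ 1 / 15) * (u * (ι 15 * m - A * s + B * s′)) - I * (ι p ^ℚ 3 * e)) I-inv ⟨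
      (+ 1 / 15) * (I * (ι 15 * b) * (ι 15 * m - A * s + B * s′)) - I * (ι p ^ℚ 3 * e)
        ≡⟨ solve 4 (λ I b F E → con (+ 1 / 15) :* (I :* (con (ι 15) :* b) :* F) :- E := I :* (b :* F) :- E)
             refl I b (ι 15 * m - A * s + B * s′) (I * (ι p ^ℚ 3 * e)) ⟩
      I * (b * (ι 15 * m - A * s + B * s′)) - I * (ι p ^ℚ 3 * e)
        ≡⟨ cong (λ u → I * u - I * (ι p ^ℚ 3 * e)) (telescope a p) ⟩
      I * (ι p * ι p * ι p * certificate a (ι p) * weight a p) - I * (ι p ^ℚ 3 * e)
        ≡⟨ solve 5 (λ I p Q w e → I :* ((p :* p) :* p :* Q :* w) :- I :* (p :* (p :* (p :* con 1ℚ)) :* e)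
             := I :* (p :* (p :* p) :* (Q :* w :- e))) refl I (ι p) (certificate a (ι p)) (weight a p) e ⟩
      I * (ι p * (ι p * ι p) * (Qw - e))
        ≡⟨ cong (λ u → I * (ι p * (ι p * ι p) * (u - e))) Qw≡ ⟩
      I * (ι p * (ι p * ι p) * (e + ι p * t - e))
        ≡⟨ solve 4 (λ I p e t → I :* (p :* (p :* p) :* (e :+ p :* t :- e))
             := p :* (p :* (p :* (p :* con 1ℚ))) :* (I :* t)) refl I (ι p) e t ⟩
      ι p ^ℚ 4 * (I * t) ∎
    conclude : Qw ≈ e → m ≡ A ÷ ι 15 * s - B ÷ ι 15 * s′ + γ a * I * z * (z + 1ℚ) * ι p ^ℚ 3 [mod-p^ 4 ]
    conclude (near t t∈ Qw≡) = mod-p^-intro 4 (I * t)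
      (moment₃∈ {a} (ℕ.<⇒≤ 5<p) a∈) (*∈ {I} {t} I∈ t∈) (difference t Qw≡)

theorem7p2 : (p : ℕ) (pr : Prime p) → 5 ℕ.< p →
    let open Localization p pr in
    (a : ℚ) (a∈ℤₚ : a ∈ ℤₚ) (a≢-1 : ¬ (a ≡ - 1ℚ [mod-p^ 1 ])) →
    let a′ = residueQuotient a a∈ℤₚ in
    ∑ p (λ k → ι k ^ℚ 3 * summand a k)
    ≡ (a ^ℚ 2 * (a + 1ℚ) ^ℚ 2 * (ι 2 * a + 1ℚ) ^ℚ 2) ÷ ι 15 * S p a
    - ((a + 1ℚ) ^ℚ 2 * (ι 4 * a ^ℚ 2 * (a + 1ℚ) ^ℚ 2 - a * (a + 1ℚ) + 1ℚ)) ÷ ι 15 * S p (a + 1ℚ)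
    + _÷_ (ι 4 * a ^ℚ 4 + ι 6 * a ^ℚ 3 - a ^ℚ 2 + a + ι 5) (ι 15 * (a + 1ℚ)) {{15[a+1]≢0 a a≢-1}}
    * a′ * (a′ + 1ℚ) * ι p ^ℚ 3
    [mod-p^ 4 ]
-- `_÷_` unfolds to multiplication by a reciprocal; `*-inverseˡ` fixes `I` as the reciprocal of 15
-- (a + 1).
theorem7p2 p pr 5<p a a∈ℤₚ a≢-1 = moment₃-congruence p pr {a} {r} {residueQuotient a a∈ℤₚ}
  5<p a∈ℤₚ a≢-1 r<p (residueQuotient∈ p pr {a} {r} a≡r) (residueQuotient-spec p pr a r)
  (*-inverseˡ (ι 15 * (a + 1ℚ)) {{15[a+1]≢0 a a≢-1}})
  where
  open Localization p pr
  r = residue a a∈ℤₚ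
  r<p : r ℕ.< p
  r<p = proj₁ (proj₁ (proj₂ (residue-exists! a a∈ℤₚ)))
  a≡r : a ≡ ι r [mod-p^ 1 ]
  a≡r = proj₂ (proj₁ (proj₂ (residue-exists! a a∈ℤₚ)))
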